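{- Let $V$ be a group-like set. If the category $\mathcal{M}_V$ has weak amalgamation, then there is a non-meager conjugacy class in $\mathrm{Homeo}(2^{\mathbb{N}},\mu_V)$.
   Context: All measures are Borel probability measures; $2^{\mathbb{N}}$ is the Cantor space. A measure is full if it is positive on every nonempty open set; the clopen values set of $\mu$ is $V_\mu=\{\mu(U): U\text{ clopen}\}$. A full measure $\mu$ on $2^{\mathbb{N}}$ is good if whenever $U,W$ are clopen with $\mu(U)<\mu(W)$, there is a clopen $W'\subseteq W$ with $\mu(W')=\mu(U)$. A set $V$ is group-like if it is countably infinite, $\{0,1\}\subseteq V\subseteq[0,1]$, and $V+\mathbb{Z}$ is an additive subgroup of $\mathbb{R}$. For group-like $V$, $\mu_V$ denotes the good measure on $2^{\mathbb{N}}$ with clopen values set $V$ (it exists and is unique up to homeomorphism). $\mathrm{Homeo}(2^{\mathbb{N}},\mu_V)$ is the Polish group (compact-open topology) of homeomorphisms of $2^{\mathbb{N}}$ preserving $\mu_V$. A clopen partition is a finite partition of $2^{\mathbb{N}}$ into nonempty clopen sets. For clopen partitions $P,R$, a $\mu_V$-morphism $R\to P$ is a surjection $p\colon R\to P$ with $\mu_V(x)=\sum_{y\in p^{ -1}(\{x\})}\mu_V(y)$ for all $x\in P$. The category $\mathcal{M}_V$: objects are matrices $A=(a_{p,p'})_{p,p'\in P}$ with entries in $V$, indexed by a clopen partition $P=P_A$ of $2^{\mathbb{N}}$, such that $\sum_{p'\in P}a_{p,p'}=\sum_{p'\in P}a_{p',p}=\mu_V(p)$ for all $p\in P$ (so all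 entries sum to $1$). A morphism from $B=(b_{q,q'})_{q,q'\in Q}$ to $A=(a_{p,p'})_{p,p'\in P}$ is a $\mu_V$-morphism $f\colon Q\to P$ such that $a_{p,p'}=\sum_{q\in f^{ -1}(p),\,q'\in f^{ -1}(p')}b_{q,q'}$ for all $p,p'\in P$. A category $\mathcal{K}$ has weak amalgamation if for every object $A$ there is a morphism $p\colon A'\to A$ such that for any morphisms $r_i\colon B_i\to A'$ ($i=0,1$) there are an object $C$ and morphisms $s_i\colon C\to B_i$ ($i=0,1$) with $p\circ r_0\circ s_0=p\circ r_1\circ s_1$. -}

module Defs where

open import Level using (Level; _⊔_; 0ℓ) renaming (suc to lsuc)
open import Algebra.Bundles using (AbelianGroup; CommutativeMonoid; Group)
import Algebra.Properties.CommutativeMonoid.Sum as Sum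
open import Data.Bool.Base using (Bool; true; false; if_then_else_)
open import Data.Fin.Base using (Fin; zero; suc; toℕ)
import Data.Fin.Properties as Fin
open import Data.Integer.Base using (ℤ)
open import Data.List.Base using (List)
open import Data.List.Relation.Unary.All using (All)
import Data.List.Relation.Unary.All as All
open import Data.List.Relation.Unary.Any using (Any)
open import Data.Nat.Base as ℕ using (ℕ)
import Data.Nat.Properties as ℕ
open import Data.Product.Base using (∃; ∃-syntax; Σ-syntax; _×_; _,_; proj₁)
open import Data.Rational as ℚ using (ℚ; 0ℚ; 1ℚ; ½)
import Data.Rational.Properties as ℚ
open import Function.Base using (_∘_; id)
open import Function.Bundles using (Bijection; Inverse)
import Function.Construct.Composition as Compose
import Function.Construct.Identity as Identity
import Function.Construct.Symmetry as Symmetry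
open import Function.Definitions using (Surjective)
open import Relation.Binary.Bundles using (Setoid)
import Relation.Binary.Construct.On as On
open import Relation.Binary.Core using (Rel)
open import Relation.Binary.PropositionalEquality as ≡ using (_≡_; _≢_; _≗_; _→-setoid_)
open import Relation.Binary.Structures using (IsEquivalence)
open import Relation.Nullary using (¬_; does)
open import Relation.Unary using (Pred; _∈_; _⊆_; _≐_; _⊢_; ∁; ⋃; _∩_; Satisfiable; _⊥_)

private
  variable
    a b i ℓ : Level

module FibreSum {a b} (𝓒 : CommutativeMonoid a b) where
  open CommutativeMonoid 𝓒 renaming (Carrier to C; _≈_ to _≋_; ε to 0#)
  private module Σ = Sum 𝓒
  open Σ using (sum; sum-syntax)

  fibreSum : ∀ {m n} → (Fin m → Fin n) → Fin n → (Fin m → C) → C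
  fibreSum {m} f p x = ∑[ q < m ] (if does (f q Fin.≟ p) then x q else 0#)

  open import Relation.Binary.Reasoning.Setoid setoid

  if-cong : ∀ b {x y} → x ≋ y → (if b then x else 0#) ≋ (if b then y else 0#)
  if-cong true  x≋y = x≋y
  if-cong false _   = refl

  if-swap : ∀ b c x → (if b then (if c then x else 0#) else 0#)
                    ≡ (if c then (if b then x else 0#) else 0#)
  if-swap true  true  x = ≡.refl
  if-swap true  false x = ≡.refl
  if-swap false true  x = ≡.refl
  if-swap false false x = ≡.refl

  if-sum : ∀ b {n} (x : Fin n → C) →
           (if b then ∑[ r < n ] x r else 0#) ≋ ∑[ r < n ] (if b then x r else 0#)
  if-sum true      x = refl
  if-sum false {n} x = sym (Σ.sum-replicate-zero n)

  fibreSum-cong : ∀ {m n} (f : Fin m → Fin n) p {x y} → (∀ q → x q ≋ y q) →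
                  fibreSum f p x ≋ fibreSum f p y
  fibreSum-cong f p x≋y = Σ.sum-cong-≋ λ q → if-cong (does (f q Fin.≟ p)) (x≋y q)

  delta : ∀ {n} (p : Fin n) (x : Fin n → C) → ∑[ q < n ] (if does (p Fin.≟ q) then x q else 0#) ≋ x p
  delta {ℕ.suc n} zero x =
    trans (∙-congˡ (Σ.sum-replicate-zero n)) (identityʳ (x zero))
  delta (suc p) x =
    trans (identityˡ _) (delta p (x ∘ suc))

  fibreSum-id : ∀ {n} (p : Fin n) (x : Fin n → C) → fibreSum id p x ≋ x p
  fibreSum-id {ℕ.suc n} zero x =
    trans (∙-congˡ (Σ.sum-replicate-zero n)) (identityʳ (x zero))
  fibreSum-id (suc p) x =
    trans (identityˡ _) (fibreSum-id p (x ∘ suc))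

  fibreSum-swap : ∀ {k l m n} (f : Fin k → Fin m) (g : Fin l → Fin n) p q (x : Fin k → Fin l → C) →
    fibreSum f p (λ i → fibreSum g q (x i)) ≋ fibreSum g q (λ j → fibreSum f p (λ i → x i j))
  fibreSum-swap {k} {l} f g p q x = begin
    ∑[ i < k ] (if F i then ∑[ j < l ] (if G j then x i j else 0#) else 0#)
      ≈⟨ Σ.sum-cong-≋ (λ i → if-sum (F i) (λ j → if G j then x i j else 0#)) ⟩
    ∑[ i < k ] ∑[ j < l ] (if F i then (if G j then x i j else 0#) else 0#)
      ≈⟨ Σ.∑-comm (λ i j → if F i then (if G j then x i j else 0#) else 0#) ⟩
    ∑[ j < l ] ∑[ i < k ] (if F i then (if G j then x i j else 0#) else 0#)
      ≈⟨ Σ.sum-cong-≋ (λ j → Σ.sum-cong-≋ λ i → reflexive (if-swap (F i) (G j) (x i j))) ⟩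
    ∑[ j < l ] ∑[ i < k ] (if G j then (if F i then x i j else 0#) else 0#)
      ≈⟨ Σ.sum-cong-≋ (λ j → if-sum (G j) (λ i → if F i then x i j else 0#)) ⟨
    ∑[ j < l ] (if G j then ∑[ i < k ] (if F i then x i j else 0#) else 0#) ∎
    where F = λ i → does (f i Fin.≟ p)
          G = λ j → does (g j Fin.≟ q)

  fibreSum-∘ : ∀ {l m n} (f : Fin m → Fin n) (g : Fin l → Fin m) p x →
               fibreSum f p (λ q → fibreSum g q x) ≋ fibreSum (f ∘ g) p x
  fibreSum-∘ {l} {m} f g p x = begin
    ∑[ q < m ] (if F q then ∑[ r < l ] (if G r q then x r else 0#) else 0#)
      ≈⟨ Σ.sum-cong-≋ (λ q → if-sum (F q) (λ r → if G r q then x r else 0#)) ⟩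
    ∑[ q < m ] ∑[ r < l ] (if F q then (if G r q then x r else 0#) else 0#)
      ≈⟨ Σ.∑-comm (λ q r → if F q then (if G r q then x r else 0#) else 0#) ⟩
    ∑[ r < l ] ∑[ q < m ] (if F q then (if G r q then x r else 0#) else 0#)
      ≈⟨ Σ.sum-cong-≋ (λ r → Σ.sum-cong-≋ λ q → reflexive (if-swap (F q) (G r q) (x r))) ⟩
    ∑[ r < l ] ∑[ q < m ] (if G r q then (if F q then x r else 0#) else 0#)
      ≈⟨ Σ.sum-cong-≋ (λ r → delta (g r) (λ q → if F q then x r else 0#)) ⟩
    ∑[ r < l ] (if F (g r) then x r else 0#) ∎
    where F = λ q → does (f q Fin.≟ p)
          G = λ r q → does (g r Fin.≟ q)

  fibreSum²-id : ∀ {n} (p p′ : Fin n) (x : Fin n → Fin n → C) →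
    fibreSum id p (λ q → fibreSum id p′ (x q)) ≋ x p p′
  fibreSum²-id p p′ x =
    trans (fibreSum-id p (λ q → fibreSum id p′ (x q))) (fibreSum-id p′ (x p))

  fibreSum²-∘ : ∀ {l m n} (f : Fin m → Fin n) (g : Fin l → Fin m) p p′
    {z : Fin n → Fin n → C} {y : Fin m → Fin m → C} {x : Fin l → Fin l → C} →
    (∀ p p′ → z p p′ ≋ fibreSum f p (λ q → fibreSum f p′ (y q))) →
    (∀ q q′ → y q q′ ≋ fibreSum g q (λ r → fibreSum g q′ (x r))) →
    z p p′ ≋ fibreSum (f ∘ g) p (λ r → fibreSum (f ∘ g) p′ (x r))
  fibreSum²-∘ f g p p′ {z} {y} {x} z≋ y≋ = begin
    z p p′
      ≈⟨ z≋ p p′ ⟩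
    fibreSum f p (λ q → fibreSum f p′ (y q))
      ≈⟨ fibreSum-cong f p (λ q → fibreSum-cong f p′ (y≋ q)) ⟩
    fibreSum f p (λ q → fibreSum f p′ (λ q′ → fibreSum g q (λ r → fibreSum g q′ (x r))))
      ≈⟨ fibreSum-cong f p (λ q → fibreSum-swap f g p′ q (λ q′ r → fibreSum g q′ (x r))) ⟩
    fibreSum f p (λ q → fibreSum g q (λ r → fibreSum f p′ (λ q′ → fibreSum g q′ (x r))))
      ≈⟨ fibreSum-cong f p (λ q → fibreSum-cong g q (λ r → fibreSum-∘ f g p′ (x r))) ⟩
    fibreSum f p (λ q → fibreSum g q (λ r → fibreSum (f ∘ g) p′ (x r)))
      ≈⟨ fibreSum-∘ f g p (λ r → fibreSum (f ∘ g) p′ (x r)) ⟩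
    fibreSum (f ∘ g) p (λ r → fibreSum (f ∘ g) p′ (x r)) ∎

Eventually : (ℕ → Set) → Set
Eventually P = ∃[ N ] ∀ n → N ℕ.≤ n → P n

-- Real numbers are Cauchy sequences of rationals, with _≈_ below as
-- their equality.
record ℝ : Set where
  field
    seq    : ℕ → ℚ
    cauchy : ∀ ε → 0ℚ ℚ.< ε →
             ∃[ N ] ∀ m n → N ℕ.≤ m → N ℕ.≤ n → ℚ.∣ seq m ℚ.- seq n ∣ ℚ.< ε
open ℝ public

infix 4 _≈_ _≤_ _<_

-- Records rather than functions, so that x and y can be inferred.
record _≈_ (x y : ℝ) : Set where
  constructor mk≈
  field close : ∀ ε → 0ℚ ℚ.< ε → Eventually λ n → ℚ.∣ seq x n ℚ.- seq y n ∣ ℚ.< ε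
open _≈_ public

record _≤_ (x y : ℝ) : Set where
  constructor mk≤
  field bound : ∀ ε → 0ℚ ℚ.< ε → Eventually λ n → seq x n ℚ.< seq y n ℚ.+ ε
open _≤_ public

record _<_ (x y : ℝ) : Set where
  constructor mk<
  field gap : ∃[ ε ] (0ℚ ℚ.< ε × Eventually λ n → seq x n ℚ.+ ε ℚ.< seq y n)
open _<_ public

private
  ∣p-p∣<ε : ∀ p {ε} → 0ℚ ℚ.< ε → ℚ.∣ p ℚ.- p ∣ ℚ.< ε
  ∣p-p∣<ε p 0<ε rewrite ℚ.+-inverseʳ p = 0<ε

  ½-positive : ∀ {ε} → 0ℚ ℚ.< ε → 0ℚ ℚ.< ½ ℚ.* ε
  ½-positive {ε} 0<ε = ≡.subst (ℚ._< ½ ℚ.* ε) (ℚ.*-zeroʳ ½) (ℚ.*-monoʳ-<-pos ½ 0<ε)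

  ½+½ : ∀ ε → ½ ℚ.* ε ℚ.+ ½ ℚ.* ε ≡ ε
  ½+½ ε = ≡.trans (≡.sym (ℚ.*-distribʳ-+ ε ½ ½)) (ℚ.*-identityˡ ε)

  ∣+∣<ε : ∀ p q ε → ℚ.∣ p ∣ ℚ.< ½ ℚ.* ε → ℚ.∣ q ∣ ℚ.< ½ ℚ.* ε → ℚ.∣ p ℚ.+ q ∣ ℚ.< ε
  ∣+∣<ε p q ε p< q< = ≡.subst (ℚ.∣ p ℚ.+ q ∣ ℚ.<_) (½+½ ε)
    (ℚ.≤-<-trans (ℚ.∣p+q∣≤∣p∣+∣q∣ p q) (ℚ.+-mono-< p< q<))

  open import Algebra.Properties.Group ℚ.+-0-group using (⁻¹-involutive)
  open import Algebra.Properties.CommutativeSemigroup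
    (CommutativeMonoid.commutativeSemigroup ℚ.+-0-commutativeMonoid) using (interchange)

  +-exchange : ∀ p q r s → (p ℚ.+ q) ℚ.- (r ℚ.+ s) ≡ (p ℚ.- r) ℚ.+ (q ℚ.- s)
  +-exchange p q r s =
    ≡.trans (≡.cong ((p ℚ.+ q) ℚ.+_) (ℚ.neg-distrib-+ r s)) (interchange p q (ℚ.- r) (ℚ.- s))

  -‿telescope : ∀ p q r → p ℚ.- r ≡ (p ℚ.- q) ℚ.+ (q ℚ.- r)
  -‿telescope p q r = ≡.sym (begin
    (p ℚ.- q) ℚ.+ (q ℚ.- r)       ≡⟨ ℚ.+-assoc p (ℚ.- q) (q ℚ.- r) ⟩
    p ℚ.+ (ℚ.- q ℚ.+ (q ℚ.- r))   ≡⟨ ≡.cong (p ℚ.+_) (ℚ.+-assoc (ℚ.- q) q (ℚ.- r)) ⟨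
    p ℚ.+ ((ℚ.- q ℚ.+ q) ℚ.- r)   ≡⟨ ≡.cong (λ t → p ℚ.+ (t ℚ.- r)) (ℚ.+-inverseˡ q) ⟩
    p ℚ.+ (0ℚ ℚ.- r)              ≡⟨ ≡.cong (p ℚ.+_) (ℚ.+-identityˡ (ℚ.- r)) ⟩
    p ℚ.- r                       ∎)
    where open ≡.≡-Reasoning

  ∣-∣-swap : ∀ p q → ℚ.∣ p ℚ.- q ∣ ≡ ℚ.∣ q ℚ.- p ∣
  ∣-∣-swap p q = begin
    ℚ.∣ p ℚ.- q ∣                   ≡⟨ ℚ.∣-p∣≡∣p∣ (p ℚ.- q) ⟨
    ℚ.∣ ℚ.- (p ℚ.- q) ∣             ≡⟨ ≡.cong ℚ.∣_∣ (ℚ.neg-distrib-+ p (ℚ.- q)) ⟩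
    ℚ.∣ ℚ.- p ℚ.+ ℚ.- (ℚ.- q) ∣     ≡⟨ ≡.cong (λ t → ℚ.∣ ℚ.- p ℚ.+ t ∣) (⁻¹-involutive q) ⟩
    ℚ.∣ ℚ.- p ℚ.+ q ∣               ≡⟨ ≡.cong ℚ.∣_∣ (ℚ.+-comm (ℚ.- p) q) ⟩
    ℚ.∣ q ℚ.- p ∣                   ∎
    where open ≡.≡-Reasoning

  ∣neg∣ : ∀ p q → ℚ.∣ ℚ.- p ℚ.- ℚ.- q ∣ ≡ ℚ.∣ p ℚ.- q ∣
  ∣neg∣ p q = ≡.trans (≡.cong ℚ.∣_∣ (≡.sym (ℚ.neg-distrib-+ p (ℚ.- q)))) (ℚ.∣-p∣≡∣p∣ (p ℚ.- q))

  ≗⇒≈ : ∀ {x y} → seq x ≗ seq y → x ≈ y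
  ≗⇒≈ {x} {y} eq = mk≈ λ ε 0<ε → 0 , λ n _ →
    ≡.subst (λ t → ℚ.∣ seq x n ℚ.- t ∣ ℚ.< ε) (eq n) (∣p-p∣<ε (seq x n) 0<ε)

fromℚ : ℚ → ℝ
fromℚ p = record { seq = λ _ → p ; cauchy = λ ε 0<ε → 0 , λ _ _ _ _ → ∣p-p∣<ε p 0<ε }

fromℤ : ℤ → ℝ
fromℤ z = fromℚ (z ℚ./ 1)

0ℝ 1ℝ : ℝ
0ℝ = fromℚ 0ℚ
1ℝ = fromℚ 1ℚ

infixl 6 _+_
infix  8 -_

_+_ : ℝ → ℝ → ℝ
x + y = record
  { seq    = λ n → seq x n ℚ.+ seq y n
  ; cauchy = λ ε 0<ε →
      let M , p = cauchy x (½ ℚ.* ε) (½-positive 0<ε)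
          N , q = cauchy y (½ ℚ.* ε) (½-positive 0<ε)
      in M ℕ.⊔ N , λ m n ≤m ≤n →
        ≡.subst (λ t → ℚ.∣ t ∣ ℚ.< ε) (≡.sym (+-exchange (seq x m) (seq y m) (seq x n) (seq y n)))
          (∣+∣<ε (seq x m ℚ.- seq x n) (seq y m ℚ.- seq y n) ε
            (p m n (ℕ.m⊔n≤o⇒m≤o M N ≤m) (ℕ.m⊔n≤o⇒m≤o M N ≤n))
            (q m n (ℕ.m⊔n≤o⇒n≤o M N ≤m) (ℕ.m⊔n≤o⇒n≤o M N ≤n)))
  }

-_ : ℝ → ℝ
- x = record
  { seq    = λ n → ℚ.- seq x n
  ; cauchy = λ ε 0<ε →
      let N , p = cauchy x ε 0<ε
      in N , λ m n ≤m ≤n →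
        ≡.subst (ℚ._< ε) (≡.sym (∣neg∣ (seq x m) (seq x n))) (p m n ≤m ≤n)
  }

≈-isEquivalence : IsEquivalence _≈_
≈-isEquivalence = record
  { refl  = λ {x} → ≗⇒≈ {x} {x} (λ _ → ≡.refl)
  ; sym   = λ {x} {y} x≈y → mk≈ λ ε 0<ε →
      let N , p = close x≈y ε 0<ε
      in N , λ n ≤n → ≡.subst (ℚ._< ε) (∣-∣-swap (seq x n) (seq y n)) (p n ≤n)
  ; trans = λ {x} {y} {z} x≈y y≈z → mk≈ λ ε 0<ε →
      let M , p = close x≈y (½ ℚ.* ε) (½-positive 0<ε)
          N , q = close y≈z (½ ℚ.* ε) (½-positive 0<ε)
      in M ℕ.⊔ N , λ n ≤n →
        ≡.subst (λ t → ℚ.∣ t ∣ ℚ.< ε) (≡.sym (-‿telescope (seq x n) (seq y n) (seq z n)))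
          (∣+∣<ε (seq x n ℚ.- seq y n) (seq y n ℚ.- seq z n) ε
            (p n (ℕ.m⊔n≤o⇒m≤o M N ≤n)) (q n (ℕ.m⊔n≤o⇒n≤o M N ≤n)))
  }

ℝ-abelianGroup : AbelianGroup 0ℓ 0ℓ
ℝ-abelianGroup = record
  { Carrier = ℝ ; _≈_ = _≈_ ; _∙_ = _+_ ; ε = 0ℝ ; _⁻¹ = -_
  ; isAbelianGroup = record
    { isGroup = record
      { isMonoid = record
        { isSemigroup = record
          { isMagma = record
            { isEquivalence = ≈-isEquivalence
            ; ∙-cong = λ {x} {y} {u} {v} x≈y u≈v → mk≈ λ ε 0<ε →
                let M , p = close x≈y (½ ℚ.* ε) (½-positive 0<ε)
                    N , q = close u≈v (½ ℚ.* ε) (½-positive 0<ε)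
                in M ℕ.⊔ N , λ n ≤n →
                  ≡.subst (λ t → ℚ.∣ t ∣ ℚ.< ε)
                    (≡.sym (+-exchange (seq x n) (seq u n) (seq y n) (seq v n)))
                    (∣+∣<ε (seq x n ℚ.- seq y n) (seq u n ℚ.- seq v n) ε
                      (p n (ℕ.m⊔n≤o⇒m≤o M N ≤n)) (q n (ℕ.m⊔n≤o⇒n≤o M N ≤n)))
            }
          ; assoc = λ x y z → ≗⇒≈ {(x + y) + z} {x + (y + z)}
              λ n → ℚ.+-assoc (seq x n) (seq y n) (seq z n)
          }
        ; identity = (λ x → ≗⇒≈ {0ℝ + x} {x} λ n → ℚ.+-identityˡ (seq x n))
                   , (λ x → ≗⇒≈ {x + 0ℝ} {x} λ n → ℚ.+-identityʳ (seq x n))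
        }
      ; inverse = (λ x → ≗⇒≈ {(- x) + x} {0ℝ} λ n → ℚ.+-inverseˡ (seq x n))
                , (λ x → ≗⇒≈ {x + - x} {0ℝ} λ n → ℚ.+-inverseʳ (seq x n))
      ; ⁻¹-cong = λ {x} {y} x≈y → mk≈ λ ε 0<ε →
          let N , p = close x≈y ε 0<ε
          in N , λ n ≤n → ≡.subst (ℚ._< ε) (≡.sym (∣neg∣ (seq x n) (seq y n))) (p n ≤n)
      }
    ; comm = λ x y → ≗⇒≈ {x + y} {y + x} λ n → ℚ.+-comm (seq x n) (seq y n)
    }
  }

module ℝ-group = AbelianGroup ℝ-abelianGroup
module ∑ = Sum ℝ-group.commutativeMonoid
open ∑ public using (sum; sum-syntax)

ConvergesTo : (ℕ → ℝ) → ℝ → Set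
ConvergesTo s x = ∀ ε → 0ℚ ℚ.< ε →
  Eventually λ n → s n < x + fromℚ ε × x < s n + fromℚ ε

-- The topology with subbasis S: W contains a finite intersection of
-- subbasic sets around each of its points.
GeneratedBy : {X : Set a} {I : Set i} → (I → Pred X b) → Pred X ℓ → Set (a ⊔ i ⊔ b ⊔ ℓ)
GeneratedBy S W = ∀ {x} → x ∈ W →
  ∃[ is ] (All (λ i → x ∈ S i) is × (∀ {y} → All (λ i → y ∈ S i) is → y ∈ W))

module Topology {X : Set a} {ℓ o} (Open : Pred X ℓ → Set o) where

  Clopen : Pred X ℓ → Set o
  Clopen U = Open U × Open (∁ U)

  -- Covers are indexed by types as large as Pred X ℓ, so that every
  -- collection of open sets is such a family.
  Compact : Pred X ℓ → Set (lsuc (a ⊔ lsuc ℓ) ⊔ o)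
  Compact K = ∀ {I : Set (a ⊔ lsuc ℓ)} (U : I → Pred X ℓ) → (∀ i → Open (U i)) →
    (∀ {x} → x ∈ K → ∃[ i ] x ∈ U i) →
    Σ[ is ∈ List I ] (∀ {x} → x ∈ K → Any (λ i → x ∈ U i) is)

  Closure : Pred X ℓ → Pred X (a ⊔ lsuc ℓ ⊔ o)
  Closure A x = ∀ W → Open W → x ∈ W → Satisfiable (W ∩ A)

  NowhereDense : Pred X ℓ → Set (a ⊔ lsuc ℓ ⊔ o)
  NowhereDense A = ∀ W → Open W → W ⊆ Closure A → ¬ Satisfiable W

  Meager : Pred X ℓ → Set (a ⊔ lsuc ℓ ⊔ o)
  Meager A = Σ[ F ∈ (ℕ → Pred X ℓ) ] ((∀ n → NowhereDense (F n)) × A ⊆ ⋃ ℕ F)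

-- Points are compared by _≗_. Open sets, hence Borel sets, are closed
-- under it automatically (open-resp and borel-resp below).
Cantor : Set
Cantor = ℕ → Bool

Cantor-setoid : Setoid 0ℓ 0ℓ
Cantor-setoid = ℕ →-setoid Bool

Open : Pred Cantor 0ℓ → Set
Open = GeneratedBy {I = ℕ × Bool} (λ (n , b) x → x n ≡ b)

open Topology Open public using (Clopen; Compact)

data Borel : Pred Cantor 0ℓ → Set₁ where
  open-set   : ∀ {U} → Open U → Borel U
  complement : ∀ {A} → Borel A → Borel (∁ A)
  union      : ∀ {A : ℕ → Pred Cantor 0ℓ} → (∀ n → Borel (A n)) → Borel (⋃ ℕ A)

clopen⇒borel : ∀ {U} → Clopen U → Borel U
clopen⇒borel (U-open , _) = open-set U-open

-- μ takes a derivation that a set is Borel as argument; by μ-cong its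
-- value depends only on the set.
record Measure : Set₁ where
  field
    μ          : ∀ {A} → Borel A → ℝ
    μ-cong     : ∀ {A B : Pred Cantor 0ℓ} (α : Borel A) (β : Borel B) → A ≐ B → μ α ≈ μ β
    μ-nonNeg   : ∀ {A} (α : Borel A) → 0ℝ ≤ μ α
    μ-additive : ∀ {A : ℕ → Pred Cantor 0ℓ} (α : ∀ n → Borel (A n)) → (∀ {m n} → m ≢ n → A m ⊥ A n) →
                 ConvergesTo (λ n → ∑[ i < n ] μ (α (toℕ i))) (μ (union α))
    μ-total    : ∀ {A} (α : Borel A) → (∀ x → x ∈ A) → μ α ≈ 1ℝ

  μᶜ : ∀ {U} → Clopen U → ℝ
  μᶜ U-clopen = μ (clopen⇒borel U-clopen)

open Measure using (μᶜ)

ClopenValues : Measure → Pred ℝ (lsuc 0ℓ)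
ClopenValues M x = ∃[ U ] Σ[ c ∈ Clopen U ] (μᶜ M c ≈ x)

Full : Measure → Set₁
Full M = ∀ {U} (o : Open U) → Satisfiable U → 0ℝ < Measure.μ M (open-set o)

record Good (M : Measure) : Set₁ where
  field
    full   : Full M
    subset : ∀ {U W} (u : Clopen U) (w : Clopen W) → μᶜ M u < μᶜ M w →
             ∃[ W′ ] Σ[ w′ ∈ Clopen W′ ] (W′ ⊆ W × μᶜ M w′ ≈ μᶜ M u)

record IsSubgroup (G : Group a b) (P : Pred (Group.Carrier G) ℓ) : Set (a ⊔ b ⊔ ℓ) where
  open Group G using (_∙_; ε; _⁻¹) renaming (_≈_ to _≈ᴳ_)
  field
    resp      : ∀ {x y} → x ≈ᴳ y → x ∈ P → y ∈ P
    ε∈        : ε ∈ P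
    ∙-closed  : ∀ {x y} → x ∈ P → y ∈ P → x ∙ y ∈ P
    ⁻¹-closed : ∀ {x} → x ∈ P → x ⁻¹ ∈ P

_+ℤ : Pred ℝ 0ℓ → Pred ℝ 0ℓ
(V +ℤ) x = ∃[ v ] ∃[ z ] (v ∈ V × x ≈ v + fromℤ z)

CountablyInfinite : Pred ℝ 0ℓ → Set
CountablyInfinite V =
  Bijection (≡.setoid ℕ) (On.setoid ℝ-group.setoid (proj₁ {A = ℝ} {B = V}))

record GroupLike (V : Pred ℝ 0ℓ) : Set where
  field
    resp      : ∀ {x y} → x ≈ y → x ∈ V → y ∈ V
    countable : CountablyInfinite V
    0∈V       : 0ℝ ∈ V
    1∈V       : 1ℝ ∈ V
    V⊆[0,1]   : ∀ {x} → x ∈ V → 0ℝ ≤ x × x ≤ 1ℝ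
    subgroup  : IsSubgroup ℝ-group.group (V +ℤ)

Continuous : (Cantor → Cantor) → Set₁
Continuous f = ∀ {U} → Open U → Open (f ⊢ U)

borel-preimage : ∀ {f} → Continuous f → ∀ {A} → Borel A → Borel (f ⊢ A)
borel-preimage f-cts (open-set o)   = open-set (f-cts o)
borel-preimage f-cts (complement α) = complement (borel-preimage f-cts α)
borel-preimage f-cts (union α)      = union (λ n → borel-preimage f-cts (α n))

open-resp : ∀ {U} → Open U → ∀ {x y} → x ≗ y → x ∈ U → y ∈ U
open-resp o x≗y x∈U with o x∈U
... | _ , x∈ , basic⊆U = basic⊆U (All.map (λ {(n , _)} → ≡.trans (≡.sym (x≗y n))) x∈)

borel-resp : ∀ {A} → Borel A → ∀ {x y} → x ≗ y → x ∈ A → y ∈ A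
borel-resp (open-set o)   x≗y x∈A       = open-resp o x≗y x∈A
borel-resp (complement α) x≗y x∉A y∈A   = x∉A (borel-resp α (≡.sym ∘ x≗y) y∈A)
borel-resp (union α)      x≗y (n , x∈A) = n , borel-resp (α n) x≗y x∈A

module _ (M : Measure) where
  open Measure M

  record Homeo : Set₁ where
    field
      bijection : Inverse Cantor-setoid Cantor-setoid
    open Inverse bijection public using (to; from; to-cong; from-cong; strictlyInverseˡ; strictlyInverseʳ)
    field
      to-continuous   : Continuous to
      from-continuous : Continuous from
      preserves       : ∀ {A} (α : Borel A) → μ (borel-preimage to-continuous α) ≈ μ α

  open Homeo

  _≈ʰ_ : Rel Homeo 0ℓ
  g ≈ʰ h = ∀ x → to g x ≗ to h x

  idʰ : Homeo
  idʰ = record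
    { bijection       = Identity.inverse Cantor-setoid
    ; to-continuous   = id
    ; from-continuous = id
    ; preserves       = λ α → μ-cong (borel-preimage id α) α (id , id)
    }

  infixl 7 _∘ʰ_

  _∘ʰ_ : Homeo → Homeo → Homeo
  g ∘ʰ h = record
    { bijection       = Compose.inverse (bijection h) (bijection g)
    ; to-continuous   = λ o → to-continuous h (to-continuous g o)
    ; from-continuous = λ o → from-continuous g (from-continuous h o)
    ; preserves       = λ α →
        let g⁻¹α = borel-preimage (to-continuous g) α
        in ℝ-group.trans
             (μ-cong (borel-preimage (λ o → to-continuous h (to-continuous g o)) α)
                     (borel-preimage (to-continuous h) g⁻¹α) (id , id))
             (ℝ-group.trans (preserves h g⁻¹α) (preserves g α))
    }

  _⁻¹ʰ : Homeo → Homeo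
  h ⁻¹ʰ = record
    { bijection       = Symmetry.inverse (bijection h)
    ; to-continuous   = from-continuous h
    ; from-continuous = to-continuous h
    ; preserves       = λ α →
        let hα = borel-preimage (from-continuous h) α
        in ℝ-group.trans (ℝ-group.sym (preserves h hα))
             (μ-cong (borel-preimage (to-continuous h) hα) α
               ( borel-resp α (strictlyInverseʳ h _)
               , borel-resp α (≡.sym ∘ strictlyInverseʳ h _)))
    }

  Homeo-group : Group (lsuc 0ℓ) 0ℓ
  Homeo-group = record
    { Carrier = Homeo ; _≈_ = _≈ʰ_ ; _∙_ = _∘ʰ_ ; ε = idʰ ; _⁻¹ = _⁻¹ʰ
    ; isGroup = record
      { isMonoid = record
        { isSemigroup = record
          { isMagma = record
            { isEquivalence = record
              { refl  = λ _ _ → ≡.refl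
              ; sym   = λ g≈h x n → ≡.sym (g≈h x n)
              ; trans = λ g≈h h≈k x n → ≡.trans (g≈h x n) (h≈k x n)
              }
            ; ∙-cong = λ {g} {g′} {h} {h′} g≈g′ h≈h′ x n →
                ≡.trans (to-cong g (h≈h′ x) n) (g≈g′ (to h′ x) n)
            }
          ; assoc = λ _ _ _ _ _ → ≡.refl
          }
        ; identity = (λ _ _ _ → ≡.refl) , (λ _ _ _ → ≡.refl)
        }
      ; inverse = (λ h → strictlyInverseʳ h) , (λ h → strictlyInverseˡ h)
      ; ⁻¹-cong = λ {g} {h} g≈h x n →
          ≡.trans (from-cong g (≡.sym ∘ strictlyInverseˡ h x) n)
            (≡.trans (from-cong g (≡.sym ∘ g≈h (from h x)) n)
              (strictlyInverseʳ g (from h x) n))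
      }
    }

  CompactOpen : Set₂
  CompactOpen = Σ[ (K , U) ∈ Pred Cantor 0ℓ × Pred Cantor 0ℓ ] (Compact K × Open U)

  HomeoOpen : Pred Homeo (lsuc 0ℓ) → Set₂
  HomeoOpen = GeneratedBy {I = CompactOpen} (λ ((K , U) , _) h → ∀ {x} → x ∈ K → to h x ∈ U)

  module HomeoTopology = Topology HomeoOpen

ConjugacyClass : (G : Group a b) → Group.Carrier G → Pred (Group.Carrier G) (a ⊔ b)
ConjugacyClass G g h = ∃[ k ] (h ≈ᴳ k ∙ g ∙ k ⁻¹)
  where open Group G using (_∙_; _⁻¹) renaming (_≈_ to _≈ᴳ_)

record Category o m e : Set (lsuc (o ⊔ m ⊔ e)) where
  infixr 9 _∘ᶜ_
  infix  4 _≈ᶜ_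
  field
    Obj       : Set o
    _⇒_       : Obj → Obj → Set m
    _≈ᶜ_      : ∀ {A B} → Rel (A ⇒ B) e
    idᶜ       : ∀ {A} → A ⇒ A
    _∘ᶜ_      : ∀ {A B C} → B ⇒ C → A ⇒ B → A ⇒ C
    ≈ᶜ-equiv  : ∀ {A B} → IsEquivalence (_≈ᶜ_ {A} {B})
    ∘ᶜ-cong   : ∀ {A B C} {f f′ : B ⇒ C} {g g′ : A ⇒ B} → f ≈ᶜ f′ → g ≈ᶜ g′ → f ∘ᶜ g ≈ᶜ f′ ∘ᶜ g′
    identityˡ : ∀ {A B} (f : A ⇒ B) → idᶜ ∘ᶜ f ≈ᶜ f
    identityʳ : ∀ {A B} (f : A ⇒ B) → f ∘ᶜ idᶜ ≈ᶜ f
    assoc     : ∀ {A B C D} (f : C ⇒ D) (g : B ⇒ C) (h : A ⇒ B) → (f ∘ᶜ g) ∘ᶜ h ≈ᶜ f ∘ᶜ (g ∘ᶜ h)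

WeakAmalgamation : ∀ {o m e} → Category o m e → Set (o ⊔ m ⊔ e)
WeakAmalgamation 𝓚 =
  ∀ A → ∃[ A′ ] Σ[ p ∈ A′ ⇒ A ]
    ∀ {B₀ B₁} (r₀ : B₀ ⇒ A′) (r₁ : B₁ ⇒ A′) →
    ∃[ C ] Σ[ s₀ ∈ C ⇒ B₀ ] Σ[ s₁ ∈ C ⇒ B₁ ]
      (p ∘ᶜ r₀ ∘ᶜ s₀ ≈ᶜ p ∘ᶜ r₁ ∘ᶜ s₁)
  where open Category 𝓚

-- The blocks are listed without repetition by Fin size.
record ClopenPartition : Set₁ where
  field
    size     : ℕ
    block    : Fin size → Pred Cantor 0ℓ
    clopen   : ∀ p → Clopen (block p)
    nonempty : ∀ p → Satisfiable (block p)
    disjoint : ∀ {p q} → p ≢ q → block p ⊥ block q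
    covers   : ∀ x → ∃[ p ] x ∈ block p

open FibreSum ℝ-group.commutativeMonoid

module _ (V : Pred ℝ 0ℓ) (M : Measure) where
  open ClopenPartition

  weight : (P : ClopenPartition) → Fin (size P) → ℝ
  weight P p = μᶜ M (clopen P p)

  record IsMorphism (R P : ClopenPartition) (f : Fin (size R) → Fin (size P)) : Set where
    field
      surjective : Surjective _≡_ _≡_ f
      weights    : ∀ p → weight P p ≈ fibreSum f p (weight R)

  record Matrix : Set₁ where
    field
      partition : ClopenPartition
      entry     : Fin (size partition) → Fin (size partition) → ℝ
      entry∈V   : ∀ p p′ → entry p p′ ∈ V
      row-sum   : ∀ p → ∑[ p′ < size partition ] entry p p′ ≈ weight partition p
      col-sum   : ∀ p → ∑[ p′ < size partition ] entry p′ p ≈ weight partition p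

  open Matrix

  -- The map acts on block indices only: block q need not be contained in
  -- block (map q).
  record MatrixMorphism (B A : Matrix) : Set where
    field
      map        : Fin (size (partition B)) → Fin (size (partition A))
      isMorphism : IsMorphism (partition B) (partition A) map
      entries    : ∀ p p′ →
        entry A p p′ ≈ fibreSum map p (λ q → fibreSum map p′ (λ q′ → entry B q q′))

  open MatrixMorphism

  private
    identity : ∀ {A} → MatrixMorphism A A
    identity {A} = record
      { map        = id
      ; isMorphism = record
        { surjective = Identity.surjective _≡_
        ; weights    = λ p → ℝ-group.sym (fibreSum-id p (weight (partition A)))
        }
      ; entries    = λ p p′ → ℝ-group.sym (fibreSum²-id p p′ (entry A))
      }

    compose : ∀ {A B C} → MatrixMorphism B C → MatrixMorphism A B → MatrixMorphism A C
    compose {A} {B} {C} F G = record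
      { map        = f ∘ g
      ; isMorphism = record
        { surjective = Compose.surjective _≡_ _≡_ _≡_ (surjective (isMorphism G)) (surjective (isMorphism F))
        ; weights    = λ p → ℝ-group.trans (weights (isMorphism F) p)
            (ℝ-group.trans
              (fibreSum-cong f p (weights (isMorphism G)))
              (fibreSum-∘ f g p (weight (partition A))))
        }
      ; entries    = λ p p′ → fibreSum²-∘ f g p p′ (entries F) (entries G)
      }
      where
      open IsMorphism
      f = map F
      g = map G

  𝓜 : Category (lsuc 0ℓ) 0ℓ 0ℓ
  𝓜 = record
    { Obj       = Matrix
    ; _⇒_       = MatrixMorphism
    ; _≈ᶜ_      = λ F G → map F ≗ map G
    ; idᶜ       = identity
    ; _∘ᶜ_      = compose
    ; ≈ᶜ-equiv  = record
      { refl  = λ _ → ≡.refl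
      ; sym   = λ F≈G q → ≡.sym (F≈G q)
      ; trans = λ F≈G G≈H q → ≡.trans (F≈G q) (G≈H q)
      }
    ; ∘ᶜ-cong   = λ {f = F} {g′ = G′} F≈F′ G≈G′ q →
        ≡.trans (≡.cong (map F) (G≈G′ q)) (F≈F′ (map G′ q))
    ; identityˡ = λ _ _ → ≡.refl
    ; identityʳ = λ _ _ → ≡.refl
    ; assoc     = λ _ _ _ _ → ≡.refl
    }

{-# OPTIONS --safe #-}
module Submission where

-- The matrix of g over a clopen partition a records the measures of
-- a = i, a ∘ g = j. Since μ is good, partitions with equal weights are exchanged
-- by the group, so a morphism onto the matrix of g is realised by a refinement of
-- a and some h that agrees with g on a. Let g be generic in two respects: every
-- partition has a refinement whose matrix is an amalgamable object over it, and g
-- decides, for each of the countably many matrices over the first n bits, whether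
-- it is realised by g over these bits or by no element near g. Weak
-- amalgamation then shows that every matrix over such an amalgamable refinement
-- is realised by g itself, hence that near each conjugate k g k⁻¹ every h can be
-- approximated by l g l⁻¹ with l close to k. So for F nowhere dense the l with
-- l g l⁻¹ ∉ F contain a dense open set, and the Baire category theorem yields a
-- conjugate of g outside any given meager set.

import Defs
open import Level using (Level; 0ℓ; Lift; lift; lower) renaming (suc to lsuc)
open import Axiom.ExcludedMiddle using (ExcludedMiddle)
open import Algebra.Bundles using (AbelianGroup)
import Algebra.Properties.CommutativeMonoid.Sum as Sum
import Algebra.Properties.Group as GroupProperties
open import Data.Bool.Base using (Bool; true; false; if_then_else_)
open import Data.Empty using (⊥-elim)
open import Data.Fin.Base using (Fin; zero; suc; toℕ; combine; remQuot; _↑ˡ_; _↑ʳ_)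
import Data.Fin.Properties as Fin
open import Data.List.Base using (List; []; _∷_; _++_; length; applyUpTo)
import Data.List.Properties as List
open import Data.List.Relation.Unary.All using (All; []; _∷_)
import Data.List.Relation.Unary.All.Properties as All
open import Data.List.Relation.Unary.Any using (Any; here; there)
import Data.List.Relation.Unary.Any.Properties as Any
open import Data.Nat.Base as ℕ using (ℕ; zero; suc; z≤n; s≤s; _⊔_; _^_)
import Data.Nat.Properties as ℕ
open import Data.Product.Base using (∃-syntax; Σ-syntax; _×_; _,_; proj₁; proj₂)
open import Data.Rational as ℚ using (ℚ; 0ℚ; ½)
import Data.Rational.Properties as ℚ
open import Data.Rational.Solver using (module +-*-Solver)
open import Data.Sum.Base as ⊎ using (_⊎_; inj₁; inj₂)
open import Data.Vec.Base using (Vec; []; _∷_; lookup; tabulate)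
import Data.Vec.Properties as Vec
open import Function.Base using (_∘_; id)
open import Function.Bundles using (Bijection)
open import Function.Definitions using (Injective)
open import Relation.Binary.Definitions using (tri<; tri≈; tri>)
open import Relation.Binary.PropositionalEquality as ≡ using (_≡_; _≢_; _≗_)
open import Relation.Nullary using (¬_; Dec; yes; no; does)
open import Relation.Nullary.Decidable using (dec-true; dec-false)
open import Relation.Unary using (Pred; _∈_; _∉_; _⊆_; _≐_; _⊥_; ∁; ∅; ⋃; _∩_; _∪_; _⊢_; Satisfiable) renaming (U to Univ)

-- Morphisms act on indices, so an object of `𝓜` carries weights and entries without tying them to
-- places; a `Labelling` puts the indices back on points. Weak amalgamation only equates composites
-- with `p`, so an occurrence of a matrix is controlled through `p` and not at the level of `A′`.
-- For this reason `A′` is taken over a partition into first bits: agreement after `p` then still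
-- means closeness of points, at a scale which the modulus of continuity of k converts into
-- closeness of l to k. Amalgamation moreover produces a new element close to g instead of working
-- inside g; the decisions built into g bridge this gap, and they can all be met because V is
-- countable. Apart from the group operations, measure preserving homeomorphisms arise in one way
-- only, also as limits in the Baire argument: from sequences of finite matchings between clopen
-- sets of equal measure.

-- Order and limits of Cauchy reals

module Reals where
  open Defs
  open ≡ using (refl; sym; trans; cong; subst; subst₂)
  open +-*-Solver using (solve; _:=_; _:+_; _:*_; :-_; _:-_; con)

  private
    variable
      x y z w : ℝ
      ε : ℚ

  -- p + r < p + s = q + r, and r cancels. Each estimate below thus becomes a sum of known
  -- inequalities and one identity for the ring solver.
  <-from-sum : ∀ {p q r s} → r ℚ.< s → p ℚ.+ s ≡ q ℚ.+ r → p ℚ.< q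
  <-from-sum {p} {q} {r} {s} r<s eq =
    subst₂ ℚ._<_ (drop p r) (drop q r)
      (ℚ.+-monoˡ-< (ℚ.- r) (subst (p ℚ.+ r ℚ.<_) eq (ℚ.+-monoʳ-< p r<s)))
    where
    drop : ∀ p r → p ℚ.+ r ℚ.- r ≡ p
    drop = solve 2 (λ p r → p :+ r :- r := p) refl

  ½-pos : 0ℚ ℚ.< ε → 0ℚ ℚ.< ½ ℚ.* ε
  ½-pos {ε} 0<ε = subst (ℚ._< ½ ℚ.* ε) (ℚ.*-zeroʳ ½) (ℚ.*-monoʳ-<-pos ½ 0<ε)

  p≤∣p∣ : ∀ p → p ℚ.≤ ℚ.∣ p ∣
  p≤∣p∣ p with ℚ.≤-total 0ℚ p
  ... | inj₁ 0≤p = ℚ.≤-reflexive (sym (ℚ.0≤p⇒∣p∣≡p 0≤p))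
  ... | inj₂ p≤0 = ℚ.≤-trans p≤0 (ℚ.0≤∣p∣ p)

  ∣p-q∣<ε⇒p<q+ε : ∀ p q → ℚ.∣ p ℚ.- q ∣ ℚ.< ε → p ℚ.< q ℚ.+ ε
  ∣p-q∣<ε⇒p<q+ε {ε} p q ∣p-q∣<ε = <-from-sum (ℚ.≤-<-trans (p≤∣p∣ (p ℚ.- q)) ∣p-q∣<ε)
    (solve 3 (λ p q e → p :+ e := q :+ e :+ (p :- q)) refl p q ε)

  ∣p-q∣≡∣q-p∣ : ∀ p q → ℚ.∣ p ℚ.- q ∣ ≡ ℚ.∣ q ℚ.- p ∣
  ∣p-q∣≡∣q-p∣ p q = trans (cong ℚ.∣_∣ (solve 2 (λ p q → p :- q := :- (q :- p)) refl p q)) (ℚ.∣-p∣≡∣p∣ (q ℚ.- p))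

  ∣p-q∣<ε⇒q<p+ε : ∀ p q → ℚ.∣ p ℚ.- q ∣ ℚ.< ε → q ℚ.< p ℚ.+ ε
  ∣p-q∣<ε⇒q<p+ε {ε} p q h = ∣p-q∣<ε⇒p<q+ε q p (subst (ℚ._< ε) (∣p-q∣≡∣q-p∣ p q) h)

  <+ε⇒∣-∣<ε : ∀ p q → p ℚ.< q ℚ.+ ε → q ℚ.< p ℚ.+ ε → ℚ.∣ p ℚ.- q ∣ ℚ.< ε
  <+ε⇒∣-∣<ε {ε} p q p<q+ε q<p+ε with ℚ.∣p∣≡p∨∣p∣≡-p (p ℚ.- q)
  ... | inj₁ eq = subst (ℚ._< ε) (sym eq) (<-from-sum p<q+ε
          (solve 3 (λ p q e → p :- q :+ (q :+ e) := e :+ p) refl p q ε))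
  ... | inj₂ eq = subst (ℚ._< ε) (sym eq) (<-from-sum q<p+ε
          (solve 3 (λ p q e → :- (p :- q) :+ (p :+ e) := e :+ q) refl p q ε))

  private
    both : ∀ {P Q : ℕ → Set} → Eventually P → Eventually Q → Eventually (λ n → P n × Q n)
    both (M , P≥) (N , Q≥) = M ℕ.⊔ N , λ n ≤n →
      P≥ n (ℕ.m⊔n≤o⇒m≤o M N ≤n) , Q≥ n (ℕ.m⊔n≤o⇒n≤o M N ≤n)

    map-eventually : ∀ {P Q : ℕ → Set} → (∀ n → P n → Q n) → Eventually P → Eventually Q
    map-eventually f (N , P≥) = N , λ n ≤n → f n (P≥ n ≤n)

  ≤-reflexive : x ≈ y → x ≤ y
  ≤-reflexive {x} {y} x≈y = mk≤ λ ε 0<ε →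
    map-eventually (λ n → ∣p-q∣<ε⇒p<q+ε (seq x n) (seq y n)) (close x≈y ε 0<ε)

  ≤-refl : x ≤ x
  ≤-refl = ≤-reflexive ℝ-group.refl

  ≤-antisym : x ≤ y → y ≤ x → x ≈ y
  ≤-antisym {x} {y} x≤y y≤x = mk≈ λ ε 0<ε →
    map-eventually (λ n (p , q) → <+ε⇒∣-∣<ε (seq x n) (seq y n) p q) (both (bound x≤y ε 0<ε) (bound y≤x ε 0<ε))

  ≤-trans : x ≤ y → y ≤ z → x ≤ z
  ≤-trans {x} {y} {z} x≤y y≤z = mk≤ λ ε 0<ε →
    map-eventually
      (λ n (p , q) → <-from-sum (ℚ.+-mono-< p q)
        (solve 4 (λ x y z e → x :+ (y :+ con ½ :* e :+ (z :+ con ½ :* e)) := z :+ e :+ (x :+ y)) refl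
          (seq x n) (seq y n) (seq z n) ε))
      (both (bound x≤y (½ ℚ.* ε) (½-pos 0<ε)) (bound y≤z (½ ℚ.* ε) (½-pos 0<ε)))

  ≤-<-trans : x ≤ y → y < z → x < z
  ≤-<-trans {x} {y} {z} x≤y (mk< (ε , 0<ε , y<z)) = mk< (½ ℚ.* ε , ½-pos 0<ε ,
    map-eventually
      (λ n (p , q) → <-from-sum (ℚ.+-mono-< p q)
        (solve 4 (λ x y z e → x :+ con ½ :* e :+ (y :+ con ½ :* e :+ z) := z :+ (x :+ (y :+ e))) refl
          (seq x n) (seq y n) (seq z n) ε))
      (both (bound x≤y (½ ℚ.* ε) (½-pos 0<ε)) y<z))

  <-≤-trans : x < y → y ≤ z → x < z
  <-≤-trans {x} {y} {z} (mk< (ε , 0<ε , x<y)) y≤z = mk< (½ ℚ.* ε , ½-pos 0<ε ,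
    map-eventually
      (λ n (p , q) → <-from-sum (ℚ.+-mono-< p q)
        (solve 4 (λ x y z e → x :+ con ½ :* e :+ (y :+ (z :+ con ½ :* e)) := z :+ (x :+ e :+ y)) refl
          (seq x n) (seq y n) (seq z n) ε))
      (both x<y (bound y≤z (½ ℚ.* ε) (½-pos 0<ε))))

  <⇒≤ : x < y → x ≤ y
  <⇒≤ {x} {y} (mk< (ε , 0<ε , x<y)) = mk≤ λ δ 0<δ → map-eventually
    (λ n p → <-from-sum (ℚ.+-mono-< (ℚ.+-mono-< p 0<ε) 0<δ)
      (solve 4 (λ x y d e → x :+ (y :+ e :+ d) := y :+ d :+ (x :+ e :+ con 0ℚ :+ con 0ℚ)) refl
        (seq x n) (seq y n) δ ε))
    x<y

  <-irrefl : ¬ (x < x)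
  <-irrefl {x} (mk< (ε , 0<ε , N , x<x)) = ℚ.<-irrefl refl (<-from-sum {0ℚ} {0ℚ} (ℚ.+-mono-< (x<x N ℕ.≤-refl) 0<ε)
      (solve 2 (λ x e → con 0ℚ :+ (x :+ e) := con 0ℚ :+ (x :+ e :+ con 0ℚ)) refl (seq x N) ε))

  +-mono-≤ : x ≤ y → z ≤ w → x + z ≤ y + w
  +-mono-≤ {x} {y} {z} {w} x≤y z≤w = mk≤ λ ε 0<ε →
    map-eventually
      (λ n (p , q) → subst (seq x n ℚ.+ seq z n ℚ.<_)
        (solve 3 (λ y w e → y :+ con ½ :* e :+ (w :+ con ½ :* e) := y :+ w :+ e) refl (seq y n) (seq w n) ε)
        (ℚ.+-mono-< p q))
      (both (bound x≤y (½ ℚ.* ε) (½-pos 0<ε)) (bound z≤w (½ ℚ.* ε) (½-pos 0<ε)))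

  +-monoʳ-< : ∀ x → y < z → x + y < x + z
  +-monoʳ-< {y} {z} x (mk< (ε , 0<ε , y<z)) = mk< (ε , 0<ε ,
    map-eventually (λ n p → subst (ℚ._< seq x n ℚ.+ seq z n) (sym (ℚ.+-assoc (seq x n) (seq y n) ε))
      (ℚ.+-monoʳ-< (seq x n) p)) y<z)

  -- Both sequences stay within ε/8 of their values at a common index, where the
  -- rational numbers can be compared.
  ≮⇒≥ : ¬ (x < y) → y ≤ x
  ≮⇒≥ {x} {y} x≮y = mk≤ λ ε 0<ε →
    let e = ½ ℚ.* (½ ℚ.* (½ ℚ.* ε))
        0<e = ½-pos (½-pos (½-pos 0<ε))
        M , cx = cauchy x e 0<e
        N , cy = cauchy y e 0<e
        K = M ℕ.⊔ N
    in K , compare ε 0<e K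
         (λ n K≤n → cx n K (ℕ.≤-trans (ℕ.m≤m⊔n M N) K≤n) (ℕ.m≤m⊔n M N))
         (λ n K≤n → cy n K (ℕ.≤-trans (ℕ.m≤n⊔m M N) K≤n) (ℕ.m≤n⊔m M N))
    where
    compare : ∀ ε → let e = ½ ℚ.* (½ ℚ.* (½ ℚ.* ε)) in 0ℚ ℚ.< e → ∀ K →
      (∀ n → K ℕ.≤ n → ℚ.∣ seq x n ℚ.- seq x K ∣ ℚ.< e) →
      (∀ n → K ℕ.≤ n → ℚ.∣ seq y n ℚ.- seq y K ∣ ℚ.< e) →
      ∀ n → K ℕ.≤ n → seq y n ℚ.< seq x n ℚ.+ ε
    compare ε 0<e K ∣x-x∣<e ∣y-y∣<e n K≤n with (seq x K ℚ.+ ½ ℚ.* ε) ℚ.<? seq y K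
    ... | yes far = ⊥-elim (x≮y (mk< (½ ℚ.* (½ ℚ.* (½ ℚ.* ε)) , 0<e , K , λ m K≤m → <-from-sum
          (ℚ.+-mono-< (ℚ.+-mono-< (∣p-q∣<ε⇒p<q+ε (seq x m) _ (∣x-x∣<e m K≤m))
                                  (∣p-q∣<ε⇒q<p+ε (seq y m) _ (∣y-y∣<e m K≤m)))
                      (ℚ.+-mono-< far 0<e))
          (solve 5 (λ xm ym xK yK ε → let e = con ½ :* (con ½ :* (con ½ :* ε)) in
              xm :+ e :+ (xK :+ e :+ (ym :+ e) :+ (yK :+ e)) := ym :+ (xm :+ yK :+ (xK :+ con ½ :* ε :+ con 0ℚ)))
            refl (seq x m) (seq y m) (seq x K) (seq y K) ε))))
    ... | no near = <-from-sum
          (ℚ.+-mono-<-≤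
            (ℚ.+-mono-< (ℚ.+-mono-< (∣p-q∣<ε⇒p<q+ε (seq y n) _ (∣y-y∣<e n K≤n))
                                    (∣p-q∣<ε⇒q<p+ε (seq x n) _ (∣x-x∣<e n K≤n)))
                        (ℚ.+-mono-< 0<e 0<e))
            (ℚ.≮⇒≥ near))
          (solve 5 (λ xn yn xK yK ε → let e = con ½ :* (con ½ :* (con ½ :* ε)) in
              yn :+ (yK :+ e :+ (xn :+ e) :+ (e :+ e) :+ (xK :+ con ½ :* ε))
                := xn :+ ε :+ (yn :+ xK :+ (con 0ℚ :+ con 0ℚ) :+ yK))
            refl (seq x n) (seq y n) (seq x K) (seq y K) ε)

  fromℚ-pos : 0ℚ ℚ.< ε → 0ℝ < fromℚ ε
  fromℚ-pos {ε} 0<ε = mk< (½ ℚ.* ε , ½-pos 0<ε , 0 , λ n _ →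
    <-from-sum (½-pos 0<ε)
      (solve 1 (λ e → con 0ℚ :+ con ½ :* e :+ con ½ :* e := e :+ con 0ℚ) refl ε))

  ½+½≈ : ∀ ε → fromℚ (½ ℚ.* ε) + fromℚ (½ ℚ.* ε) ≈ fromℚ ε
  ½+½≈ ε = mk≈ λ δ 0<δ → 0 , λ n _ → subst (λ t → ℚ.∣ t ∣ ℚ.< δ)
    (solve 1 (λ e → con 0ℚ := con ½ :* e :+ con ½ :* e :- e) refl ε) 0<δ

  ≤-by-ε : (∀ ε → 0ℚ ℚ.< ε → x ≤ y + fromℚ ε) → x ≤ y
  ≤-by-ε {x} {y} x≤y+ = mk≤ λ ε 0<ε →
    map-eventually
      {λ n → seq x n ℚ.< seq y n ℚ.+ ½ ℚ.* ε ℚ.+ ½ ℚ.* ε}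
      (λ n → subst (seq x n ℚ.<_)
        (solve 2 (λ y e → y :+ con ½ :* e :+ con ½ :* e := y :+ e) refl (seq y n) ε))
      (bound (x≤y+ (½ ℚ.* ε) (½-pos 0<ε)) (½ ℚ.* ε) (½-pos 0<ε))

  +-congˡ : ∀ x {y z} → y ≈ z → x + y ≈ x + z
  +-congˡ x {y} {z} y≈z = ℝ-group.∙-cong {x} {x} {y} {z} ℝ-group.refl y≈z

  +-identityʳ : ∀ x → x + 0ℝ ≈ x
  +-identityʳ x = ℝ-group.identityʳ x

  x≤x+y : ∀ x {y} → 0ℝ ≤ y → x ≤ x + y
  x≤x+y x {y} 0≤y = ≤-trans (≤-reflexive (ℝ-group.sym (+-identityʳ x))) (+-mono-≤ {x} {x} {0ℝ} {y} ≤-refl 0≤y)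

  x<x+y : ∀ x {y} → 0ℝ < y → x < x + y
  x<x+y x {y} 0<y = ≤-<-trans (≤-reflexive (ℝ-group.sym (+-identityʳ x))) (+-monoʳ-< {0ℝ} {y} x 0<y)

  sum-nonNeg : ∀ {n} (f : Fin n → ℝ) → (∀ i → 0ℝ ≤ f i) → 0ℝ ≤ sum f
  sum-nonNeg {ℕ.zero} f 0≤f = ≤-refl
  sum-nonNeg {ℕ.suc n} f 0≤f =
    ≤-trans (0≤f zero) (x≤x+y (f zero) (sum-nonNeg (f ∘ suc) (0≤f ∘ suc)))

  ≤-½-½ : ∀ {x y z ε} → x ≤ y + fromℚ (½ ℚ.* ε) → y ≤ z + fromℚ (½ ℚ.* ε) → x ≤ z + fromℚ ε
  ≤-½-½ {x} {y} {z} {ε} x≤y+ y≤z+ = ≤-trans x≤y+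
    (≤-trans (+-mono-≤ {y} {z + ½ε} {½ε} {½ε} y≤z+ ≤-refl)
      (≤-reflexive (ℝ-group.trans (ℝ-group.assoc z ½ε ½ε) (+-congˡ z (½+½≈ ε)))))
    where ½ε = fromℚ (½ ℚ.* ε)

  limit-mono : ∀ {s t x y} → ConvergesTo s x → ConvergesTo t y → Eventually (λ n → s n ≤ t n) → x ≤ y
  limit-mono {s} {t} {x} {y} s→x t→y (K , s≤t) = ≤-by-ε λ ε 0<ε →
    let M , s→ = s→x (½ ℚ.* ε) (½-pos 0<ε)
        N , t→ = t→y (½ ℚ.* ε) (½-pos 0<ε)
        n = K ℕ.⊔ (M ℕ.⊔ N)
        _ , x<s+ = s→ n (ℕ.≤-trans (ℕ.m≤m⊔n M N) (ℕ.m≤n⊔m K (M ℕ.⊔ N)))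
        t<y+ , _ = t→ n (ℕ.≤-trans (ℕ.m≤n⊔m M N) (ℕ.m≤n⊔m K (M ℕ.⊔ N)))
    in ≤-½-½ {x} {s n} {y} {ε} (<⇒≤ x<s+) (≤-trans (s≤t n (ℕ.m≤m⊔n K (M ℕ.⊔ N))) (<⇒≤ t<y+))

-- Cylinders, clopen sets and labellings of Cantor space

module CantorSpace where
  open Defs
  open ≡ using (refl; sym; trans; cong; cong₂; subst)

  infix 4 _≡[_]_

  _≡[_]_ : Cantor → ℕ → Cantor → Set
  x ≡[ n ] y = ∀ {i} → i ℕ.< n → x i ≡ y i

  ≡[]-sym : ∀ {x y n} → x ≡[ n ] y → y ≡[ n ] x
  ≡[]-sym x≡y i<n = sym (x≡y i<n)

  ≡[]-trans : ∀ {x y z n} → x ≡[ n ] y → y ≡[ n ] z → x ≡[ n ] z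
  ≡[]-trans x≡y y≡z i<n = trans (x≡y i<n) (y≡z i<n)

  ≡[]-mono : ∀ {x y m n} → m ℕ.≤ n → x ≡[ n ] y → x ≡[ m ] y
  ≡[]-mono m≤n x≡y i<m = x≡y (ℕ.<-≤-trans i<m m≤n)

  ≡[]-⊔ˡ : ∀ m n {x y} → x ≡[ m ⊔ n ] y → x ≡[ m ] y
  ≡[]-⊔ˡ m n = ≡[]-mono (ℕ.m≤m⊔n m n)

  ≡[]-⊔ʳ : ∀ m n {x y} → x ≡[ m ⊔ n ] y → x ≡[ n ] y
  ≡[]-⊔ʳ m n = ≡[]-mono (ℕ.m≤n⊔m m n)

  ≗⇒≡[] : ∀ {x y n} → x ≗ y → x ≡[ n ] y
  ≗⇒≡[] x≗y {i} _ = x≗y i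

  ≡[]⇒≗ : ∀ {x y} → (∀ n → x ≡[ n ] y) → x ≗ y
  ≡[]⇒≗ x≡y i = x≡y (suc i) ℕ.≤-refl

  open⇒cylinder : ∀ {U} → Open U → ∀ {x} → x ∈ U → ∃[ n ] (∀ {y} → x ≡[ n ] y → y ∈ U)
  open⇒cylinder U-open {x} x∈U with U-open x∈U
  ... | is , x∈ , ⊆U = let n , x≡⇒ = cylinder is x∈ in n , ⊆U ∘ x≡⇒
    where
    cylinder : ∀ is → All (λ (n , b) → x n ≡ b) is →
               ∃[ n ] (∀ {y} → x ≡[ n ] y → All (λ (n , b) → y n ≡ b) is)
    cylinder []             []          = 0 , λ _ → []
    cylinder ((i , b) ∷ is) (xi≡b ∷ x∈) with cylinder is x∈
    ... | n , x≡⇒ = suc i ⊔ n , λ x≡y →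
            trans (sym (≡[]-⊔ˡ (suc i) n x≡y ℕ.≤-refl)) xi≡b ∷ x≡⇒ (≡[]-⊔ʳ (suc i) n x≡y)

  cylinder⇒open : ∀ {U} → (∀ {x} → x ∈ U → ∃[ n ] (∀ {y} → x ≡[ n ] y → y ∈ U)) → Open U
  cylinder⇒open cyl {x} x∈U with cyl x∈U
  ... | n , ⊆U = applyUpTo f n , All.applyUpTo⁺₁ f n (λ _ → refl) , λ y∈ → ⊆U λ i<n → sym (All.applyUpTo⁻ f n y∈ i<n)
    where
    f = λ i → i , x i

  -- A clopen set with an explicit modulus; that every clopen set has one is `clopen⇒loc`, by
  -- compactness.
  record Loc (U : Pred Cantor 0ℓ) : Set where
    constructor loc
    field
      depth : ℕ
      resp  : ∀ {x y} → x ≡[ depth ] y → x ∈ U → y ∈ U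
  open Loc public

  loc-∅ : Loc ∅
  loc-∅ = loc 0 λ _ ()

  loc-U : Loc Univ
  loc-U = loc 0 λ _ _ → _

  loc-∁ : ∀ {U} → Loc U → Loc (∁ U)
  loc-∁ u = loc (depth u) λ x≡y x∉U y∈U → x∉U (resp u (≡[]-sym x≡y) y∈U)

  loc-∩ : ∀ {U W} → Loc U → Loc W → Loc (U ∩ W)
  loc-∩ u w = loc (depth u ⊔ depth w) λ x≡y (x∈U , x∈W) →
    resp u (≡[]-⊔ˡ (depth u) _ x≡y) x∈U , resp w (≡[]-⊔ʳ (depth u) _ x≡y) x∈W

  loc-∪ : ∀ {U W} → Loc U → Loc W → Loc (U ∪ W)
  loc-∪ u w = loc (depth u ⊔ depth w) λ x≡y →
    ⊎.map (resp u (≡[]-⊔ˡ (depth u) _ x≡y)) (resp w (≡[]-⊔ʳ (depth u) _ x≡y))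

  loc⇒open : ∀ {U} → Loc U → Open U
  loc⇒open u = cylinder⇒open λ x∈U → depth u , λ x≡y → resp u x≡y x∈U

  loc⇒clopen : ∀ {U} → Loc U → Clopen U
  loc⇒clopen u = loc⇒open u , loc⇒open (loc-∁ u)

  -- The latest bit comes first, so that the children of a node s are `true ∷ s` and `false ∷ s`.
  prefix : Cantor → ℕ → List Bool
  prefix x zero    = []
  prefix x (suc n) = x n ∷ prefix x n

  prefix-≡ : ∀ {x y} n → prefix x n ≡ prefix y n → x ≡[ n ] y
  prefix-≡ (suc n) eq i<n with ℕ.m≤n⇒m<n∨m≡n (ℕ.s≤s⁻¹ i<n)
  ... | inj₁ i<n  = prefix-≡ n (List.∷-injectiveʳ eq) i<n
  ... | inj₂ refl = List.∷-injectiveˡ eq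

  length-prefix : ∀ x n → length (prefix x n) ≡ n
  length-prefix x zero    = refl
  length-prefix x (suc n) = cong suc (length-prefix x n)

  -- A clopen partition given by its label map. Labels outside the image stand for empty blocks, so
  -- products of labellings need no pruning.
  record Labelling (k : ℕ) : Set where
    constructor labelling
    field
      label  : Cantor → Fin k
      ldepth : ℕ
      lresp  : ∀ {x y} → x ≡[ ldepth ] y → label x ≡ label y
  open Labelling public

  mapˡ : ∀ {k l} → (Fin k → Fin l) → Labelling k → Labelling l
  mapˡ f a = labelling (f ∘ label a) (ldepth a) (cong f ∘ lresp a)

  ⟨_,_⟩ : ∀ {k l} → Labelling k → Labelling l → Labelling (k ℕ.* l)
  ⟨ a , b ⟩ = labelling (λ x → combine (label a x) (label b x)) (ldepth a ⊔ ldepth b) λ x≡y →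
    cong₂ combine (lresp a (≡[]-⊔ˡ (ldepth a) _ x≡y)) (lresp b (≡[]-⊔ʳ (ldepth a) _ x≡y))

  loc-label : ∀ {k} (a : Labelling k) (P : Pred (Fin k) 0ℓ) → Loc (label a ⊢ P)
  loc-label a P = loc (ldepth a) λ x≡y → subst P (lresp a x≡y)

  bit : Bool → Fin 2
  bit false = zero
  bit true  = suc zero

  bit-injective : ∀ {b c} → bit b ≡ bit c → b ≡ c
  bit-injective {false} {false} _ = refl
  bit-injective {true}  {true}  _ = refl

  bit-surjective : ∀ p → ∃[ b ] bit b ≡ p
  bit-surjective zero       = false , refl
  bit-surjective (suc zero) = true , refl

  firstBits : ∀ n → Labelling (2 ℕ.^ n)
  firstBits n = labelling (bits n) n (bits-resp n)
    where
    bits : ∀ n → Cantor → Fin (2 ℕ.^ n)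
    bits zero    x = zero
    bits (suc n) x = combine (bit (x 0)) (bits n (x ∘ suc))

    bits-resp : ∀ n {x y} → x ≡[ n ] y → bits n x ≡ bits n y
    bits-resp zero    x≡y = refl
    bits-resp (suc n) x≡y = cong₂ combine (cong bit (x≡y (s≤s z≤n))) (bits-resp n (x≡y ∘ s≤s))

  firstBits-injective : ∀ n {x y} → label (firstBits n) x ≡ label (firstBits n) y → x ≡[ n ] y
  firstBits-injective (suc n) {x} {y} eq {zero}  _ =
    bit-injective (Fin.combine-injectiveˡ (bit (x 0)) _ (bit (y 0)) _ eq)
  firstBits-injective (suc n) {x} {y} eq {suc i} (s≤s i<n) =
    firstBits-injective n {x ∘ suc} {y ∘ suc} (Fin.combine-injectiveʳ (bit (x 0)) _ (bit (y 0)) _ eq) i<n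

  firstBits-surjective : ∀ n j → ∃[ x ] label (firstBits n) x ≡ j
  firstBits-surjective zero    zero = (λ _ → false) , refl
  firstBits-surjective (suc n) j =
    let p , q , p,q≡j = Fin.combine-surjective {2} {2 ℕ.^ n} j
        b , b≡p = bit-surjective p
        x , x≡q = firstBits-surjective n q
    in cons b x , trans (cong₂ combine b≡p x≡q) p,q≡j
    where
    cons : Bool → Cantor → Cantor
    cons b x zero    = b
    cons b x (suc i) = x i

  -- Compactness of Cantor space

  module Compactness (lem : ∀ {ℓ} → ExcludedMiddle ℓ) where

    private
      variable
        ℓ : Level

    -- Otherwise Φ fails along a whole branch, against `bar`: by `join`, a failing node has a
    -- failing child. Φ may live at any level because it also speaks of subcovers indexed by large
    -- types.
    fan : (Φ : List Bool → Set ℓ) → (∀ s → Φ (true ∷ s) → Φ (false ∷ s) → Φ s) →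
          (∀ x → ∃[ n ] Φ (prefix x n)) → Φ []
    fan Φ join bar with lem {P = Φ []}
    ... | yes Φ[] = Φ[]
    ... | no ¬Φ[] = ⊥-elim (let n , Φn = bar path in bad n Φn)
      where
      -- If Φ holds at the child `true` of a failing node, it must fail at the child `false`.
      turn : ∀ {s} → Dec (Φ (true ∷ s)) → Bool
      turn (yes _) = false
      turn (no  _) = true

      node : ℕ → List Bool
      node zero    = []
      node (suc n) = turn (lem {P = Φ (true ∷ node n)}) ∷ node n

      path : Cantor
      path n = turn (lem {P = Φ (true ∷ node n)})

      prefix-path : ∀ n → prefix path n ≡ node n
      prefix-path zero    = refl
      prefix-path (suc n) = cong (path n ∷_) (prefix-path n)

      node-bad : ∀ n → ¬ Φ (node n)
      node-bad zero = ¬Φ[]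
      node-bad (suc n) with lem {P = Φ (true ∷ node n)}
      ... | yes Φt = λ Φf → node-bad n (join (node n) Φt Φf)
      ... | no ¬Φt = ¬Φt

      bad : ∀ n → ¬ Φ (prefix path n)
      bad n = node-bad n ∘ subst Φ (prefix-path n)

    Cyl : List Bool → Pred Cantor 0ℓ
    Cyl s x = prefix x (length s) ≡ s

    cyl-prefix : ∀ {x y n} → y ∈ Cyl (prefix x n) → x ≡[ n ] y
    cyl-prefix {x} {y} {n} y∈ =
      prefix-≡ n (sym (subst (λ m → prefix y m ≡ prefix x n) (length-prefix x n) y∈))

    open-cyl : ∀ {U} → Open U → ∀ {x} → x ∈ U → ∃[ n ] (Cyl (prefix x n) ⊆ U)
    open-cyl U-open x∈U = let n , ⊆U = open⇒cylinder U-open x∈U in n , λ y∈ → ⊆U (cyl-prefix y∈)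

    clopen⇒compact : ∀ {K} → Clopen K → Compact K
    clopen⇒compact {K} (K-open , K′-open) U U-open cover =
      let is , ⊆U = fan Φ
            (λ s (is , t⊆) (js , f⊆) → is ++ js , λ {x} x∈s x∈K → join s is js t⊆ f⊆ (x (length s)) refl x∈s x∈K)
            local
      in is , ⊆U refl
      where
      Φ = λ s → Σ[ is ∈ List _ ] (∀ {x} → x ∈ Cyl s → x ∈ K → Any (λ i → x ∈ U i) is)

      join : ∀ s is js →
        (∀ {x} → x ∈ Cyl (true ∷ s) → x ∈ K → Any (λ i → x ∈ U i) is) →
        (∀ {x} → x ∈ Cyl (false ∷ s) → x ∈ K → Any (λ i → x ∈ U i) js) →
        ∀ {x} b → x (length s) ≡ b → x ∈ Cyl s → x ∈ K → Any (λ i → x ∈ U i) (is ++ js)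
      join s is js t⊆ f⊆ true  eq x∈s x∈K = Any.++⁺ˡ (t⊆ (cong₂ _∷_ eq x∈s) x∈K)
      join s is js t⊆ f⊆ false eq x∈s x∈K = Any.++⁺ʳ is (f⊆ (cong₂ _∷_ eq x∈s) x∈K)

      local : ∀ x → ∃[ n ] Φ (prefix x n)
      local x with lem {P = x ∈ K}
      ... | yes x∈K = let i , x∈U = cover x∈K
                          n , ⊆U = open-cyl (U-open i) x∈U
                      in n , i ∷ [] , λ y∈ _ → here (⊆U y∈)
      ... | no x∉K = let n , ⊆K′ = open-cyl K′-open x∉K
                     in n , [] , λ y∈ y∈K → ⊥-elim (⊆K′ y∈ y∈K)

    -- Near each point U is constant, since U and its complement are open; `fan` makes the depth
    -- uniform.
    clopen⇒loc : ∀ {U} → Clopen U → Loc U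
    clopen⇒loc {U} (U-open , U′-open) =
      let n , ⊆U = fan Φ
            -- Agreement up to `suc (length s)` puts x and y below the same child of s.
            (λ s (m , t⊆) (n , f⊆) → suc (length s) ⊔ (m ⊔ n) , λ {x} x∈s y∈s x≡y x∈U →
               join s m n t⊆ f⊆ (x (length s)) refl x∈s y∈s x≡y x∈U)
            local
      in loc n (⊆U refl refl)
      where
      Φ = λ s → ∃[ n ] (∀ {x y} → x ∈ Cyl s → y ∈ Cyl s → x ≡[ n ] y → x ∈ U → y ∈ U)

      join : ∀ s m n →
        (∀ {x y} → x ∈ Cyl (true ∷ s) → y ∈ Cyl (true ∷ s) → x ≡[ m ] y → x ∈ U → y ∈ U) →
        (∀ {x y} → x ∈ Cyl (false ∷ s) → y ∈ Cyl (false ∷ s) → x ≡[ n ] y → x ∈ U → y ∈ U) →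
        ∀ {x y} b → x (length s) ≡ b → x ∈ Cyl s → y ∈ Cyl s →
        x ≡[ suc (length s) ⊔ (m ⊔ n) ] y → x ∈ U → y ∈ U
      join s m n t⊆ f⊆ {x} {y} b eq x∈s y∈s x≡y = go b eq
        where
        x≡y′ = ≡[]-⊔ʳ (suc (length s)) (m ⊔ n) x≡y
        y-eq : ∀ {b} → x (length s) ≡ b → y (length s) ≡ b
        y-eq = trans (sym (≡[]-⊔ˡ (suc (length s)) (m ⊔ n) x≡y ℕ.≤-refl))
        go : ∀ b → x (length s) ≡ b → x ∈ U → y ∈ U
        go true  eq = t⊆ (cong₂ _∷_ eq x∈s) (cong₂ _∷_ (y-eq eq) y∈s) (≡[]-⊔ˡ m n x≡y′)
        go false eq = f⊆ (cong₂ _∷_ eq x∈s) (cong₂ _∷_ (y-eq eq) y∈s) (≡[]-⊔ʳ m n x≡y′)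

      local : ∀ x → ∃[ n ] Φ (prefix x n)
      local x with lem {P = x ∈ U}
      ... | yes x∈U = let n , ⊆U = open-cyl U-open x∈U in n , 0 , λ _ y∈ _ _ → ⊆U y∈
      ... | no x∉U = let n , ⊆U′ = open-cyl U′-open x∉U in n , 0 , λ x∈ _ _ x∈U → ⊥-elim (⊆U′ x∈ x∈U)

    -- Each output bit is a clopen condition on the input, hence depends on finitely many input
    -- bits.
    uniform : ∀ {f} → Continuous f → ∀ n → ∃[ m ] (∀ {x y} → x ≡[ m ] y → f x ≡[ n ] f y)
    uniform f-cts zero = 0 , λ _ ()
    uniform {f} f-cts (suc n) = depth u ⊔ m , λ {x} {y} x≡y {i} i<1+n → agree x≡y (ℕ.m≤n⇒m<n∨m≡n (ℕ.s≤s⁻¹ i<1+n))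
      where
      m = proj₁ (uniform f-cts n)
      u : Loc (f ⊢ λ y → y n ≡ true)
      u = clopen⇒loc (f-cts (proj₁ clopen) , f-cts (proj₂ clopen))
        where clopen = loc⇒clopen (loc (suc n) λ x≡y → trans (sym (x≡y ℕ.≤-refl)))

      agree : ∀ {x y i} → x ≡[ depth u ⊔ m ] y → i ℕ.< n ⊎ i ≡ n → f x i ≡ f y i
      agree x≡y (inj₁ i<n) = proj₂ (uniform f-cts n) (≡[]-⊔ʳ (depth u) m x≡y) i<n
      agree {x} {y} x≡y (inj₂ refl) with f x n in fx | f y n in fy
      ... | true  | true  = refl
      ... | false | false = refl
      ... | true  | false = trans (sym (resp u (≡[]-⊔ˡ (depth u) m x≡y) fx)) fy
      ... | false | true  = trans (sym fx) (resp u (≡[]-sym (≡[]-⊔ˡ (depth u) m x≡y)) fy)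

-- Borel measures and their determination by clopen sets

module MeasureTheory (lem : ∀ {ℓ} → ExcludedMiddle ℓ) where
  open Defs
  open ≡ using (refl)
  open Reals
  open CantorSpace
  open Measure using (μᶜ)

  private
    variable
      A B C : Pred Cantor 0ℓ

  pair : Pred Cantor 0ℓ → Pred Cantor 0ℓ → ℕ → Pred Cantor 0ℓ
  pair A B zero    = A
  pair A B (suc _) = B

  infixr 6 _∪₂_
  infix  7 _∖_

  _∪₂_ : Pred Cantor 0ℓ → Pred Cantor 0ℓ → Pred Cantor 0ℓ
  A ∪₂ B = ⋃ ℕ (pair A B)

  ∪₂-elim : A ∪₂ B ⊆ A ∪ B
  ∪₂-elim (zero  , x∈A) = inj₁ x∈A
  ∪₂-elim (suc _ , x∈B) = inj₂ x∈B

  ∪₂-intro : A ∪ B ⊆ A ∪₂ B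
  ∪₂-intro (inj₁ x∈A) = 0 , x∈A
  ∪₂-intro (inj₂ x∈B) = 1 , x∈B

  borel-∪ : Borel A → Borel B → Borel (A ∪₂ B)
  borel-∪ α β = union λ { zero → α ; (suc _) → β }

  -- Written with complements and unions, so that a `Borel` derivation comes directly from the
  -- constructors.
  _∖_ : Pred Cantor 0ℓ → Pred Cantor 0ℓ → Pred Cantor 0ℓ
  A ∖ B = ∁ (∁ A ∪₂ B)

  ∖-intro : ∀ {x} → x ∈ A → x ∉ B → x ∈ A ∖ B
  ∖-intro x∈A x∉B (zero  , x∉A) = x∉A x∈A
  ∖-intro x∈A x∉B (suc _ , x∈B) = x∉B x∈B

  ∖-∉ : ∀ {x} → x ∈ A ∖ B → x ∉ B
  ∖-∉ x∈ x∈B = x∈ (1 , x∈B)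

  ∖-∈ : A ∖ B ⊆ A
  ∖-∈ {A} {B} {x} x∈ with lem {P = x ∈ A}
  ... | yes x∈A = x∈A
  ... | no  x∉A = ⊥-elim (x∈ (0 , x∉A))

  ∪-∖ : ∀ A {B} → B ⊆ A ∪ B ∖ A
  ∪-∖ A {B} {x} x∈B with lem {P = x ∈ A}
  ... | yes x∈A = inj₁ x∈A
  ... | no  x∉A = inj₂ (∖-intro x∈B x∉A)

  borel-∖ : Borel A → Borel B → Borel (A ∖ B)
  borel-∖ α β = complement (borel-∪ (complement α) β)

  borel-∅ : Borel ∅
  borel-∅ = open-set λ ()

  loc⇒borel : Loc A → Borel A
  loc⇒borel u = clopen⇒borel (loc⇒clopen u)

  Increasing : (ℕ → Pred Cantor 0ℓ) → Set
  Increasing B = ∀ n → B n ⊆ B (suc n)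

  increasing-≤ : ∀ {B} → Increasing B → ∀ {m n} → m ℕ.≤ n → B m ⊆ B n
  increasing-≤ {B} B⊆ m≤n = go (ℕ.≤⇒≤′ m≤n)
    where
    go : ∀ {m n} → m ℕ.≤′ n → B m ⊆ B n
    go (ℕ.≤′-reflexive refl) = id
    go {n = suc n} (ℕ.≤′-step m≤n) = B⊆ n ∘ go m≤n

  ∖-increasing-disjoint : ∀ {B} → Increasing B → ∀ {m n} → m ≢ n → (B (suc m) ∖ B m) ⊥ (B (suc n) ∖ B n)
  ∖-increasing-disjoint B⊆ {m} {n} m≢n (x∈m , x∈n) with ℕ.<-cmp m n
  ... | tri< m<n _ _ = ∖-∉ x∈n (increasing-≤ B⊆ m<n (∖-∈ x∈m))
  ... | tri≈ _ m≡n _ = m≢n m≡n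
  ... | tri> _ _ n<m = ∖-∉ x∈m (increasing-≤ B⊆ n<m (∖-∈ x∈n))

  module _ (M : Measure) where
    open Measure M

    eventually-const : ∀ {s x c} → ConvergesTo s x → Eventually (λ n → s n ≈ c) → x ≈ c
    eventually-const {s} {x} {c} s→x (N , s≈c) = ≤-antisym
      (limit-mono s→x const (N , λ n N≤n → ≤-reflexive (s≈c n N≤n)))
      (limit-mono const s→x (N , λ n N≤n → ≤-reflexive (ℝ-group.sym (s≈c n N≤n))))
      where
      const : ConvergesTo (λ _ → c) c
      const ε 0<ε = 0 , λ _ _ → x<x+y c (fromℚ-pos 0<ε) , x<x+y c (fromℚ-pos 0<ε)

    -- Countably many copies of ∅ are disjoint with union ∅, while their partial sums reach `c + c`.
    -- Hence `c + c ≤ c`, which excludes `0 < c`.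
    μ-∅ : μ borel-∅ ≈ 0ℝ
    μ-∅ = ≤-antisym (≮⇒≥ λ 0<c → <-irrefl (<-≤-trans (x<x+y c 0<c) 2c≤c)) (μ-nonNeg borel-∅)
      where
      c = μ borel-∅
      c≈ : μ (union λ _ → borel-∅) ≈ c
      c≈ = μ-cong (union λ _ → borel-∅) borel-∅ ((λ ()) , λ ())
      2c≤c : c + c ≤ c
      2c≤c = ≤-trans
        (limit-mono {s = λ _ → c + c}
          (λ ε 0<ε → 0 , λ _ _ → x<x+y (c + c) (fromℚ-pos 0<ε) , x<x+y (c + c) (fromℚ-pos 0<ε))
          (μ-additive (λ _ → borel-∅) (λ _ ()))
          (2 , λ { (suc (suc n)) _ → +-mono-≤ {c} {c} {c} {c + sum {n} (λ _ → c)} ≤-refl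
                     (x≤x+y c (sum-nonNeg {n} (λ _ → c) (λ _ → μ-nonNeg borel-∅))) ; 0 () ; 1 (ℕ.s≤s ()) }))
        (≤-reflexive c≈)

    μ-∪ : (α : Borel A) (β : Borel B) (γ : Borel C) → A ⊥ B → C ≐ A ∪ B → μ γ ≈ μ α + μ β
    μ-∪ {A} {B} {C} α β γ A⊥B (C⊆ , ⊆C) = ℝ-group.trans
      (μ-cong γ (union three) (to ∘ C⊆ , ⊆C ∘ from))
      (eventually-const (μ-additive three disjoint) (2 , two))
      where
      S : ℕ → Pred Cantor 0ℓ
      S 0             = A
      S 1             = B
      S (suc (suc _)) = ∅
      three : ∀ n → Borel (S n)
      three 0             = α
      three 1             = β
      three (suc (suc _)) = borel-∅
      to : A ∪ B ⊆ ⋃ ℕ S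
      to (inj₁ x∈A) = 0 , x∈A
      to (inj₂ x∈B) = 1 , x∈B
      from : ⋃ ℕ S ⊆ A ∪ B
      from (0 , x∈A) = inj₁ x∈A
      from (1 , x∈B) = inj₂ x∈B
      disjoint : ∀ {m n} → m ≢ n → S m ⊥ S n
      disjoint {0} {0} m≢n _ = m≢n refl
      disjoint {0} {1} _ x∈  = A⊥B x∈
      disjoint {1} {0} _ (x∈B , x∈A) = A⊥B (x∈A , x∈B)
      disjoint {1} {1} m≢n _ = m≢n refl
      two : ∀ n → 2 ℕ.≤ n → sum {n} (λ i → μ (three (toℕ i))) ≈ μ α + μ β
      two (suc (suc n)) _ = +-congˡ (μ α) (ℝ-group.trans
        (+-congˡ (μ β) (ℝ-group.trans (∑.sum-cong-≋ {n} {λ _ → μ borel-∅} {λ _ → 0ℝ} (λ _ → μ-∅)) (∑.sum-replicate-zero n)))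
        (+-identityʳ (μ β)))
      two 1 (ℕ.s≤s ())

    μ-mono : (α : Borel A) (β : Borel B) → A ⊆ B → μ α ≤ μ β
    μ-mono {A} {B} α β A⊆B = ≤-trans (x≤x+y (μ α) (μ-nonNeg (borel-∖ β α)))
      (≤-reflexive (ℝ-group.sym (μ-∪ α (borel-∖ β α) β (λ (x∈A , x∈) → ∖-∉ x∈ x∈A) (∪-∖ A , ⊎.[ A⊆B , ∖-∈ ]))))

    μ-subadditive : (α : Borel A) (β : Borel B) (γ : Borel C) → C ⊆ A ∪ B → μ γ ≤ μ α + μ β
    μ-subadditive {A} {B} {C} α β γ C⊆ = ≤-trans
      (μ-mono γ γ′ (∪₂-intro ∘ split ∘ C⊆))
      (≤-trans (≤-reflexive (μ-∪ α (borel-∖ β α) γ′ (λ (x∈A , x∈) → ∖-∉ x∈ x∈A) (∪₂-elim , ∪₂-intro)))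
        (+-mono-≤ {μ α} {μ α} {μ (borel-∖ β α)} {μ β} ≤-refl (μ-mono (borel-∖ β α) β ∖-∈)))
      where
      γ′ = borel-∪ α (borel-∖ β α)
      split : A ∪ B ⊆ A ∪ B ∖ A
      split = ⊎.[ inj₁ , ∪-∖ A ]′

    module _ {B : ℕ → Pred Cantor 0ℓ} (β : ∀ n → Borel (B n)) (B⊆ : Increasing B) where

      private
        S : ℕ → Pred Cantor 0ℓ
        S zero    = B 0
        S (suc n) = B (suc n) ∖ B n

        σ : ∀ n → Borel (S n)
        σ zero    = β 0
        σ (suc n) = borel-∖ (β (suc n)) (β n)

        S⊆B : ∀ n → S n ⊆ B n
        S⊆B zero    = id
        S⊆B (suc n) = ∖-∈

        disjoint : ∀ {m n} → m ≢ n → S m ⊥ S n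
        disjoint {zero}  {zero}  m≢n _         = m≢n refl
        disjoint {zero}  {suc n} _   (x∈ , x∈′) = ∖-∉ x∈′ (increasing-≤ B⊆ (ℕ.z≤n {n}) x∈)
        disjoint {suc m} {zero}  _   (x∈′ , x∈) = ∖-∉ x∈′ (increasing-≤ B⊆ (ℕ.z≤n {m}) x∈)
        disjoint {suc m} {suc n} m≢n x∈        = ∖-increasing-disjoint B⊆ (λ { refl → m≢n refl }) x∈

        B⊆⋃S : ∀ n → B n ⊆ ⋃ ℕ S
        B⊆⋃S zero x∈ = 0 , x∈
        B⊆⋃S (suc n) {x} x∈ with lem {P = x ∈ B n}
        ... | yes x∈B = B⊆⋃S n x∈B
        ... | no  x∉B = suc n , ∖-intro x∈ x∉B

      sum-∖ : ∀ n → μ (β 0) + sum {n} (λ i → μ (borel-∖ (β (suc (toℕ i))) (β (toℕ i)))) ≈ μ (β n)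
      sum-∖ = go β B⊆
        where
        go : ∀ {B : ℕ → Pred Cantor 0ℓ} (β : ∀ n → Borel (B n)) → Increasing B → ∀ n →
             μ (β 0) + sum {n} (λ i → μ (borel-∖ (β (suc (toℕ i))) (β (toℕ i)))) ≈ μ (β n)
        go β B⊆ zero = +-identityʳ (μ (β 0))
        -- The first difference is absorbed into `β 0` and the sequence is shifted by one, which is
        -- why `go` lets B vary.
        go {B} β B⊆ (suc n) = ℝ-group.trans
          (ℝ-group.sym (ℝ-group.assoc (μ (β 0)) (μ δ₀) Σδ))
          (ℝ-group.trans
            (ℝ-group.∙-cong {μ (β 0) + μ δ₀} {μ (β 1)} {Σδ} {Σδ}
              (ℝ-group.sym (μ-∪ (β 0) δ₀ (β 1) (λ (x∈ , x∈′) → ∖-∉ x∈′ x∈) (∪-∖ (B 0) , ⊎.[ B⊆ 0 , ∖-∈ ])))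
              ℝ-group.refl)
            (go (β ∘ suc) (B⊆ ∘ suc) n))
          where
          δ₀ = borel-∖ (β 1) (β 0)
          Σδ = sum {n} (λ i → μ (borel-∖ (β (suc (suc (toℕ i)))) (β (suc (toℕ i)))))

      -- The successive differences are disjoint with the same union, and their partial sums
      -- telescope to the measure of `B n`; convergence of these sums bounds the remainder.
      continuity : ∀ ε → 0ℚ ℚ.< ε → Eventually λ n → μ (borel-∖ (union β) (β n)) ≤ fromℚ ε
      continuity ε 0<ε = let N , s→ = μ-additive σ disjoint ε 0<ε in N , λ n N≤n →
        let ⋃∖B = μ (borel-∖ (union β) (β n))
            μ⋃≈ = μ-∪ (β n) (borel-∖ (union β) (β n)) (union β) (λ (x∈ , x∈′) → ∖-∉ x∈′ x∈) (∪-∖ (B n) , ⊎.[ (n ,_) , ∖-∈ ])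
            μ⋃≈′ = μ-cong (union β) (union σ) ((λ (m , x∈) → B⊆⋃S m x∈) , λ (m , x∈) → m , S⊆B m x∈)
            -- The first `suc n` terms, of indices 0 to n, add up to the measure of `B n`.
            _ , μ⋃<s+ε = s→ (suc n) (ℕ.m≤n⇒m≤1+n N≤n)
        in ≮⇒≥ λ ε<⋃∖B → <-irrefl {μ (union β)} (<-≤-trans (≤-<-trans (≤-reflexive μ⋃≈′) μ⋃<s+ε)
             (≤-trans
               (≤-reflexive (ℝ-group.∙-cong {sum {suc n} (λ i → μ (σ (toℕ i)))} {μ (β n)} {fromℚ ε} {fromℚ ε} (sum-∖ n) ℝ-group.refl))
               (≤-trans (<⇒≤ (+-monoʳ-< {fromℚ ε} {⋃∖B} (μ (β n)) ε<⋃∖B)) (≤-reflexive (ℝ-group.sym μ⋃≈)))))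

  -- Every Borel set is approximated by clopen sets, simultaneously for both
  -- measures: the difference is covered by a Borel set that is small for each.
  module _ (M N : Measure) (agree : ∀ {U} (u : Loc U) → μᶜ M (loc⇒clopen u) ≈ μᶜ N (loc⇒clopen u)) where
    private
      module M = Measure M
      module N = Measure N

    record Approx (A : Pred Cantor 0ℓ) (ε : ℚ) : Set₁ where
      field
        {core} : Pred Cantor 0ℓ
        core-loc : Loc core
        {error} : Pred Cantor 0ℓ
        error-borel : Borel error
        A⊆ : A ⊆ core ∪ error
        ⊆A : core ⊆ A ∪ error
        M-small : M.μ error-borel ≤ fromℚ ε
        N-small : N.μ error-borel ≤ fromℚ ε
    open Approx

    Approximable : Pred Cantor 0ℓ → Set₁
    Approximable A = ∀ ε → 0ℚ ℚ.< ε → Approx A ε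

    approximable-resp : A ≐ B → Approximable A → Approximable B
    approximable-resp (A⊆B , B⊆A) approx ε 0<ε = let a = approx ε 0<ε in record
      { core-loc = core-loc a ; error-borel = error-borel a
      ; A⊆ = A⊆ a ∘ B⊆A ; ⊆A = ⊎.map₁ A⊆B ∘ ⊆A a ; M-small = M-small a ; N-small = N-small a }

    loc-approximable : Loc A → Approximable A
    loc-approximable u ε 0<ε = record
      { core-loc = u ; error-borel = borel-∅ ; A⊆ = inj₁ ; ⊆A = inj₁
      ; M-small = ≤-trans (≤-reflexive (μ-∅ M)) (<⇒≤ (fromℚ-pos 0<ε))
      ; N-small = ≤-trans (≤-reflexive (μ-∅ N)) (<⇒≤ (fromℚ-pos 0<ε)) }

    complement-approximable : Approximable A → Approximable (∁ A)
    complement-approximable approx ε 0<ε = let a = approx ε 0<ε in record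
      { core-loc = loc-∁ (core-loc a) ; error-borel = error-borel a
      ; A⊆ = λ {x} → swap (λ x → ⊆A a {x}) x ; ⊆A = λ {x} → swap (λ x → A⊆ a {x}) x ; M-small = M-small a ; N-small = N-small a }
      where
      swap : (∀ x → x ∈ A → x ∈ B ⊎ x ∈ C) → ∀ x → x ∉ B → x ∉ A ⊎ x ∈ C
      swap {A} A⊆ x x∉B with lem {P = x ∈ A}
      ... | no  x∉A = inj₁ x∉A
      ... | yes x∈A = inj₂ (⊎.[ ⊥-elim ∘ x∉B , id ] (A⊆ x x∈A))

    ∪-approx : ∀ {A B ε} → Approx A (½ ℚ.* ε) → Approx B (½ ℚ.* ε) → Approx (A ∪₂ B) ε
    ∪-approx {ε = ε} a b = record
      { core-loc = loc-∪ (core-loc a) (core-loc b) ; error-borel = borel-∪ (error-borel a) (error-borel b)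
      ; A⊆ = ⊎.[ ⊎.map inj₁ (∪₂-intro ∘ inj₁) ∘ A⊆ a , ⊎.map inj₂ (∪₂-intro ∘ inj₂) ∘ A⊆ b ] ∘ ∪₂-elim
      ; ⊆A = ⊎.[ ⊎.map (∪₂-intro ∘ inj₁) (∪₂-intro ∘ inj₁) ∘ ⊆A a
                 , ⊎.map (∪₂-intro ∘ inj₂) (∪₂-intro ∘ inj₂) ∘ ⊆A b ]
      ; M-small = small M (M-small a) (M-small b)
      ; N-small = small N (N-small a) (N-small b) }
      where
      ½ε = fromℚ (½ ℚ.* ε)
      small : ∀ L → Measure.μ L (error-borel a) ≤ ½ε → Measure.μ L (error-borel b) ≤ ½ε →
              Measure.μ L (borel-∪ (error-borel a) (error-borel b)) ≤ fromℚ ε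
      small L a≤ b≤ = ≤-trans (μ-subadditive L (error-borel a) (error-borel b) _ ∪₂-elim)
        (≤-trans (+-mono-≤ {L.μ (error-borel a)} {½ε} {L.μ (error-borel b)} {½ε} a≤ b≤) (≤-reflexive (½+½≈ ε)))
        where module L = Measure L

    limit-approximable : ∀ {B} (β : ∀ n → Borel (B n)) → Increasing B → (∀ n → Approximable (B n)) → Approximable (⋃ ℕ B)
    limit-approximable {B} β B⊆ approx ε 0<ε =
      let m , M-tail = continuity M β B⊆ (½ ℚ.* ε) (½-pos 0<ε)
          n , N-tail = continuity N β B⊆ (½ ℚ.* ε) (½-pos 0<ε)
          k = m ℕ.⊔ n
          tail : Approx (⋃ ℕ B ∖ B k) (½ ℚ.* ε)
          tail = record
            { core-loc = loc-∅ ; error-borel = borel-∖ (union β) (β k) ; A⊆ = inj₂ ; ⊆A = λ ()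
            ; M-small = M-tail k (ℕ.m≤m⊔n m n) ; N-small = N-tail k (ℕ.m≤n⊔m m n) }
          a = ∪-approx (approx k (½ ℚ.* ε) (½-pos 0<ε)) tail
          back : B k ∪₂ (⋃ ℕ B ∖ B k) ⊆ ⋃ ℕ B
          back x∈ = ⊎.[ (k ,_) , ∖-∈ ]′ (∪₂-elim x∈)
      in record
      { core-loc = core-loc a ; error-borel = error-borel a
      ; A⊆ = A⊆ a ∘ ∪₂-intro ∘ ∪-∖ (B k) ; ⊆A = ⊎.map₁ back ∘ ⊆A a ; M-small = M-small a ; N-small = N-small a }

    -- U is the increasing union of the sets `inner n` of points whose cylinder of length n lies in
    -- U, and `inner n` is determined by n bits.
    open-approximable : ∀ {U} → Open U → Approximable U
    open-approximable {U} U-open = approximable-resp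
      ( (λ (n , ⊆U) → ⊆U (λ _ → refl)) , λ x∈U → let n , ⊆U = open⇒cylinder U-open x∈U in n , λ {y} → ⊆U {y})
      (limit-approximable (loc⇒borel ∘ inner-loc) (λ n ⊆U {y} x≡y → ⊆U {y} (≡[]-mono (ℕ.n≤1+n n) x≡y))
        (loc-approximable ∘ inner-loc))
      where
      inner : ℕ → Pred Cantor 0ℓ
      inner n x = ∀ {y} → x ≡[ n ] y → y ∈ U
      inner-loc : ∀ n → Loc (inner n)
      inner-loc n = loc n λ x≡y ⊆U {z} y≡z → ⊆U {z} (≡[]-trans x≡y y≡z)

    union-approximable : ∀ {A} (α : ∀ n → Borel (A n)) → (∀ n → Approximable (A n)) → Approximable (⋃ ℕ A)
    union-approximable {A} α approx = approximable-resp ((λ (n , x∈) → to n x∈) , λ (n , x∈) → n , from n x∈)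
      (limit-approximable α′ (λ n → ∪₂-intro ∘ inj₁) approx-⋃A)
      where
      ⋃A : ℕ → Pred Cantor 0ℓ
      ⋃A zero    = A 0
      ⋃A (suc n) = ⋃A n ∪₂ A (suc n)
      α′ : ∀ n → Borel (⋃A n)
      α′ zero    = α 0
      α′ (suc n) = borel-∪ (α′ n) (α (suc n))
      approx-⋃A : ∀ n → Approximable (⋃A n)
      approx-⋃A zero    = approx 0
      approx-⋃A (suc n) ε 0<ε = ∪-approx (approx-⋃A n _ (½-pos 0<ε)) (approx (suc n) _ (½-pos 0<ε))
      to : ∀ n → ⋃A n ⊆ ⋃ ℕ A
      to zero x∈ = 0 , x∈
      to (suc n) x∈ = ⊎.[ to n , (suc n ,_) ] (∪₂-elim x∈)
      from : ∀ n → A n ⊆ ⋃A n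
      from zero    = id
      from (suc n) = ∪₂-intro ∘ inj₂

    borel-approximable : Borel A → Approximable A
    borel-approximable (open-set o)   = open-approximable o
    borel-approximable (complement α) = complement-approximable (borel-approximable α)
    borel-approximable (union α)      = union-approximable α (λ n → borel-approximable (α n))

    borel-agree : (α : Borel A) → M.μ α ≈ N.μ α
    borel-agree {A} α = ≤-antisym
      (≤-by-ε λ ε 0<ε → let a = borel-approximable α (½ ℚ.* ε) (½-pos 0<ε) in
        bounded M N a (agree (core-loc a)) (M-small a) (N-small a))
      (≤-by-ε λ ε 0<ε → let a = borel-approximable α (½ ℚ.* ε) (½-pos 0<ε) in
        bounded N M a (ℝ-group.sym (agree (core-loc a))) (N-small a) (M-small a))
      where
      bounded : ∀ K L {ε} (a : Approx A (½ ℚ.* ε)) →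
        μᶜ K (loc⇒clopen (core-loc a)) ≈ μᶜ L (loc⇒clopen (core-loc a)) →
        Measure.μ K (error-borel a) ≤ fromℚ (½ ℚ.* ε) → Measure.μ L (error-borel a) ≤ fromℚ (½ ℚ.* ε) →
        Measure.μ K α ≤ Measure.μ L α + fromℚ ε
      bounded K L {ε} a K≈L K-small L-small = ≤-½-½ {K.μ α} {K.μ υ} {L.μ α} {ε}
        (≤-trans (μ-subadditive K υ δ α (A⊆ a)) (+-mono-≤ {K.μ υ} {K.μ υ} {K.μ δ} {½ε} ≤-refl K-small))
        (≤-trans (≤-reflexive K≈L)
          (≤-trans (μ-subadditive L α δ υ (⊆A a)) (+-mono-≤ {L.μ α} {L.μ α} {L.μ δ} {½ε} ≤-refl L-small)))
        where
        module K = Measure K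
        module L = Measure L
        υ = loc⇒borel (core-loc a)
        δ = error-borel a
        ½ε = fromℚ (½ ℚ.* ε)

  -- Compared with M by `borel-agree`, it reduces invariance of M under f to clopen sets.
  push-forward : ∀ M {f} → Continuous f → Measure
  push-forward M {f} f-cts = record
    { μ          = μ ∘ borel-preimage f-cts
    ; μ-cong     = λ α β A≐B → μ-cong (borel-preimage f-cts α) (borel-preimage f-cts β) (proj₁ A≐B , proj₂ A≐B)
    ; μ-nonNeg   = μ-nonNeg ∘ borel-preimage f-cts
    ; μ-additive = λ α disjoint → μ-additive (borel-preimage f-cts ∘ α) (λ m≢n {x} → disjoint m≢n {f x})
    ; μ-total    = λ α all → μ-total (borel-preimage f-cts α) (all ∘ f)
    }
    where open Measure M

-- Finite combinatorics of a good measure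

module Labellings (lem : ∀ {ℓ} → ExcludedMiddle ℓ) where
  open Defs using (Cantor; module FibreSum)
  open CantorSpace

  -- The values are an abstract group because the sum of two Cauchy sequences
  -- unfolds, so that the summands could not be inferred from it.
  record Content : Set₁ where
    field
      values : AbelianGroup 0ℓ 0ℓ
    open AbelianGroup values renaming (Carrier to C; _≈_ to _≋_; _∙_ to _+_; ε to 0#) public
    open Sum commutativeMonoid public
    field
      m      : ∀ {U} → Loc U → C
      m-cong : ∀ {U W} (u : Loc U) (w : Loc W) → U ≐ W → m u ≋ m w
      m-∪    : ∀ {U W Z} (u : Loc U) (w : Loc W) (z : Loc Z) → U ⊥ W → Z ≐ U ∪ W → m z ≋ m u + m w
      m-∅    : ∀ {U} (u : Loc U) → (∀ x → x ∉ U) → m u ≋ 0#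
      m-full : ∀ {U} (u : Loc U) → m u ≋ 0# → ∀ x → x ∉ U
      Val    : Pred C 0ℓ
      0∈Val  : 0# ∈ Val
      m∈Val  : ∀ {U} (u : Loc U) → m u ∈ Val
      split  : ∀ {n U} (u : Loc U) v (f : Fin n → C) → v ∈ Val → (∀ i → f i ∈ Val) → m u ≋ v + sum f →
               ∃[ W ] Σ[ w ∈ Loc W ] (W ⊆ U × m w ≋ v)

  module Combinatorics (𝓒 : Content) where
    open Content 𝓒
    open FibreSum commutativeMonoid
    open GroupProperties group using (∙-cancelˡ)
    open import Relation.Binary.Reasoning.Setoid setoid

    sum-splitAt : ∀ k {l} (f : Fin (k ℕ.+ l) → C) →
                  sum f ≋ sum (λ i → f (i ↑ˡ l)) + sum (λ j → f (k ↑ʳ j))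
    sum-splitAt zero    f = sym (identityˡ _)
    sum-splitAt (suc k) f = trans (∙-congˡ (sum-splitAt k (f ∘ suc))) (sym (assoc _ _ _))

    sum-combine : ∀ k {l} (f : Fin (k ℕ.* l) → C) → sum f ≋ sum {k} (λ i → sum {l} (λ j → f (combine i j)))
    sum-combine zero        f = refl
    sum-combine (suc k) {l} f = trans (sum-splitAt l f) (∙-congˡ (sum-combine k (λ j → f (l ↑ʳ j))))

    fibreSum-combine : ∀ {k l n o} (f : Fin k → Fin n) (g : Fin l → Fin o) (F : Fin (k ℕ.* l) → Fin (n ℕ.* o)) →
      (∀ p q → F (combine p q) ≡ combine (f p) (g q)) → ∀ (v : Fin (k ℕ.* l) → C) i j →
      fibreSum F (combine i j) v ≋ fibreSum {k} f i (λ p → fibreSum {l} g j (λ q → v (combine p q)))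
    fibreSum-combine {k} {l} f g F F≡ v i j = begin
      fibreSum F (combine i j) v
        ≈⟨ sum-combine k (λ c → if does (F c Fin.≟ combine i j) then v c else 0#) ⟩
      sum {k} (λ p → sum {l} (λ q → if does (F (combine p q) Fin.≟ combine i j) then v (combine p q) else 0#))
        ≈⟨ sum-cong-≋ (λ p → sum-cong-≋ (λ q → entry p q)) ⟩
      sum {k} (λ p → sum {l} (λ q → if does (f p Fin.≟ i) then (if does (g q Fin.≟ j) then v (combine p q) else 0#) else 0#))
        ≈⟨ sum-cong-≋ (λ p → if-sum (does (f p Fin.≟ i)) {l} (λ q → if does (g q Fin.≟ j) then v (combine p q) else 0#)) ⟨
      fibreSum f i (λ p → fibreSum g j (λ q → v (combine p q))) ∎
      where
      entry : ∀ p q → (if does (F (combine p q) Fin.≟ combine i j) then v (combine p q) else 0#) ≋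
        (if does (f p Fin.≟ i) then (if does (g q Fin.≟ j) then v (combine p q) else 0#) else 0#)
      entry p q with f p Fin.≟ i | g q Fin.≟ j
      ... | yes ≡.refl | yes ≡.refl = reflexive (≡.cong (λ b → if b then v (combine p q) else 0#)
              (dec-true (F (combine p q) Fin.≟ combine i j) (F≡ p q)))
      ... | yes ≡.refl | no gq≢j = reflexive (≡.cong (λ b → if b then v (combine p q) else 0#)
              (dec-false (F (combine p q) Fin.≟ combine i j)
                (λ eq → gq≢j (Fin.combine-injectiveʳ (f p) (g q) i j (≡.trans (≡.sym (F≡ p q)) eq)))))
      ... | no fp≢i | _ = reflexive (≡.cong (λ b → if b then v (combine p q) else 0#)
              (dec-false (F (combine p q) Fin.≟ combine i j)
                (λ eq → fp≢i (Fin.combine-injectiveˡ (f p) (g q) i j (≡.trans (≡.sym (F≡ p q)) eq)))))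

    m-sum : ∀ {n} {E : Fin n → Pred Cantor 0ℓ} {D} (e : ∀ q → Loc (E q)) (d : Loc D) →
            (∀ {p q} → p ≢ q → E p ⊥ E q) → (∀ q → E q ⊆ D) → (∀ x → x ∈ D → ∃[ q ] x ∈ E q) →
            m d ≋ sum (λ q → m (e q))
    m-sum {zero} e d E⊥ E⊆D D⊆E = m-∅ d λ x x∈D → Fin.¬Fin0 (proj₁ (D⊆E x x∈D))
    m-sum {suc n} {E} {D} e d E⊥ E⊆D D⊆E = begin
      m d                                  ≈⟨ m-∪ (e zero) d′ d (λ (x∈ , _ , x∉) → x∉ x∈)
                                                ((λ {x} → to x) , ⊎.[ E⊆D zero , proj₁ ]) ⟩
      m (e zero) + m d′                    ≈⟨ ∙-congˡ (m-sum (e ∘ suc) d′ (λ p≢q → E⊥ (p≢q ∘ Fin.suc-injective))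
                                                (λ q x∈ → E⊆D (suc q) x∈ , λ x∈₀ → E⊥ Fin.0≢1+n (x∈₀ , x∈))
                                                (λ x (x∈ , x∉) → rest x∉ (D⊆E x x∈))) ⟩
      m (e zero) + sum (λ q → m (e (suc q))) ∎
      where
      d′ = loc-∩ d (loc-∁ (e zero))
      to : ∀ x → x ∈ D → x ∈ E zero ∪ D ∩ ∁ (E zero)
      to x x∈ with lem {P = x ∈ E zero}
      ... | yes x∈₀ = inj₁ x∈₀
      ... | no  x∉₀ = inj₂ (x∈ , x∉₀)
      rest : ∀ {x} → x ∉ E zero → ∃[ q ] x ∈ E q → ∃[ q ] x ∈ E (suc q)
      rest x∉ (zero  , x∈) = ⊥-elim (x∉ x∈)
      rest x∉ (suc q , x∈) = q , x∈

    at : ∀ {k} (a : Labelling k) i → Loc (label a ⊢ (_≡ i))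
    at a i = loc-label a (_≡ i)

    wt : ∀ {k} → Labelling k → Fin k → C
    wt a i = m (at a i)

    joint : ∀ {k l} → Labelling k → Labelling l → Fin k → Fin l → C
    joint a b i j = m (loc-∩ (at a i) (at b j))

    m-fibre : ∀ {U k n} (u : Loc U) (d : Labelling k) (a : Labelling n) (f : Fin k → Fin n) → f ∘ label d ≗ label a →
              ∀ i → m (loc-∩ u (at a i)) ≋ fibreSum f i (λ q → m (loc-∩ u (at d q)))
    m-fibre {U} u d a f f∘d≗a i = begin
      m (loc-∩ u (at a i))
        ≈⟨ m-sum pieces (loc-∩ u (at a i))
             (λ p≢q (((_ , p≡) , _) , ((_ , q≡) , _)) → p≢q (≡.trans (≡.sym p≡) q≡))
             (λ q {x} ((x∈ , dx≡q) , fq≡i) → x∈ , ≡.trans (≡.sym (f∘d≗a x)) (≡.trans (≡.cong f dx≡q) fq≡i))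
             (λ x (x∈ , ax≡i) → label d x , (x∈ , ≡.refl) , ≡.trans (f∘d≗a x) ax≡i) ⟩
      sum (λ q → m (pieces q))
        ≈⟨ sum-cong-≋ piece ⟩
      fibreSum f i (λ q → m (loc-∩ u (at d q))) ∎
      where
      -- The last factor does not vary with the point: it is everything or nothing according to
      -- `f q ≡ i`. This makes the condition inside `fibreSum` part of the set.
      pieces : ∀ q → Loc ((U ∩ (label d ⊢ (_≡ q))) ∩ (λ _ → f q ≡ i))
      pieces q = loc-∩ (loc-∩ u (at d q)) (loc 0 λ _ → id)
      piece : ∀ q → m (pieces q) ≋ (if does (f q Fin.≟ i) then m (loc-∩ u (at d q)) else 0#)
      piece q with f q Fin.≟ i
      ... | yes fq≡i = m-cong (pieces q) (loc-∩ u (at d q)) (proj₁ , λ x∈ → x∈ , fq≡i)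
      ... | no  fq≢i = m-∅ (pieces q) λ x (_ , fq≡i) → fq≢i fq≡i

    m-swap : ∀ {U W} (u : Loc U) (w : Loc W) → m (loc-∩ u w) ≋ m (loc-∩ w u)
    m-swap u w = m-cong _ _ ((λ (x∈U , x∈W) → x∈W , x∈U) , λ (x∈W , x∈U) → x∈U , x∈W)

    wt-fibre : ∀ {k n} (d : Labelling k) (a : Labelling n) (f : Fin k → Fin n) → f ∘ label d ≗ label a →
               ∀ i → wt a i ≋ fibreSum f i (wt d)
    wt-fibre d a f f∘d≗a i = begin
      m (at a i)                                     ≈⟨ m-cong _ _ ((_ ,_) , proj₂) ⟩
      m (loc-∩ loc-U (at a i))                       ≈⟨ m-fibre loc-U d a f f∘d≗a i ⟩
      fibreSum f i (λ q → m (loc-∩ loc-U (at d q)))  ≈⟨ fibreSum-cong f i (λ q → m-cong _ _ (proj₂ , (_ ,_))) ⟩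
      fibreSum f i (wt d)                            ∎

    joint-fibre : ∀ {k l n o} (c : Labelling k) (d : Labelling l) (a : Labelling n) (b : Labelling o)
      (f : Fin k → Fin n) (g : Fin l → Fin o) → f ∘ label c ≗ label a → g ∘ label d ≗ label b →
      ∀ i j → joint a b i j ≋ fibreSum f i (λ p → fibreSum g j (λ q → joint c d p q))
    joint-fibre c d a b f g f∘c≗a g∘d≗b i j = begin
      m (loc-∩ (at a i) (at b j))                          ≈⟨ m-swap (at a i) (at b j) ⟩
      m (loc-∩ (at b j) (at a i))                          ≈⟨ m-fibre (at b j) c a f f∘c≗a i ⟩
      fibreSum f i (λ p → m (loc-∩ (at b j) (at c p)))     ≈⟨ fibreSum-cong f i (λ p → m-swap (at b j) (at c p)) ⟩
      fibreSum f i (λ p → m (loc-∩ (at c p) (at b j)))     ≈⟨ fibreSum-cong f i (λ p → m-fibre (at c p) d b g g∘d≗b j) ⟩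
      fibreSum f i (λ p → fibreSum g j (λ q → joint c d p q)) ∎

    joint-row : ∀ {k l} (a : Labelling k) (b : Labelling l) i → sum (λ j → joint a b i j) ≋ wt a i
    joint-row a b i = sym (m-sum (λ j → loc-∩ (at a i) (at b j)) (at a i)
      (λ p≢q ((_ , p≡) , (_ , q≡)) → p≢q (≡.trans (≡.sym p≡) q≡)) (λ _ → proj₁) (λ x x∈ → label b x , x∈ , ≡.refl))

    joint-col : ∀ {k l} (a : Labelling k) (b : Labelling l) j → sum (λ i → joint a b i j) ≋ wt b j
    joint-col a b j = trans (sum-cong-≋ (λ i → m-swap (at a i) (at b j))) (joint-row b a j)

    wt-⟨⟩ : ∀ {k l} (a : Labelling k) (b : Labelling l) i j → wt ⟨ a , b ⟩ (combine i j) ≋ joint a b i j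
    wt-⟨⟩ a b i j = m-cong _ _
      ( (λ {x} → Fin.combine-injective (label a x) (label b x) i j)
      , λ (a≡ , b≡) → ≡.cong₂ combine a≡ b≡)

    wt-∃ : ∀ {k} (a : Labelling k) {i} → ¬ (wt a i ≋ 0#) → ∃[ x ] label a x ≡ i
    wt-∃ a {i} wt≢0 with lem {P = ∃[ x ] label a x ≡ i}
    ... | yes found = found
    ... | no  none  = ⊥-elim (wt≢0 (m-∅ (at a i) λ x x∈ → none (x , x∈)))

    wt-label : ∀ {k} (a : Labelling k) x → ¬ (wt a (label a x) ≋ 0#)
    wt-label a x wt≈0 = m-full (at a (label a x)) wt≈0 x ≡.refl

    -- Both sets are unions of blocks over the same labels. In `Limit` this yields invariance of the
    -- measure.
    m-label : ∀ {k} (a b : Labelling k) → (∀ i → wt a i ≋ wt b i) → ∀ P → m (loc-label a P) ≋ m (loc-label b P)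
    m-label a b same P = trans (decompose a) (trans (sum-cong-≋ piece) (sym (decompose b)))
      where
      inside : ∀ i → Loc (λ _ → P i)
      inside i = loc 0 λ _ → id
      decompose : ∀ a → m (loc-label a P) ≋ sum (λ i → m (loc-∩ (at a i) (inside i)))
      decompose a = m-sum (λ i → loc-∩ (at a i) (inside i)) (loc-label a P)
        (λ p≢q ((p≡ , _) , (q≡ , _)) → p≢q (≡.trans (≡.sym p≡) q≡))
        (λ { q {x} (≡.refl , Pq) → Pq })
        (λ x Px → label a x , ≡.refl , Px)
      piece : ∀ i → m (loc-∩ (at a i) (inside i)) ≋ m (loc-∩ (at b i) (inside i))
      piece i with lem {P = P i}
      ... | yes Pi = trans (m-cong (loc-∩ (at a i) (inside i)) (at a i) (proj₁ , (_, Pi)))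
                       (trans (same i) (m-cong (at b i) (loc-∩ (at b i) (inside i)) ((_, Pi) , proj₁)))
      ... | no ¬Pi = trans (m-∅ (loc-∩ (at a i) (inside i)) (λ _ → ¬Pi ∘ proj₂))
                       (sym (m-∅ (loc-∩ (at b i) (inside i)) (λ _ → ¬Pi ∘ proj₂)))

    max : ∀ {k} (f : Fin k → ℕ) → ∃[ n ] (∀ i → f i ℕ.≤ n)
    max {zero}  f = 0 , λ ()
    max {suc k} f = let n , f≤ = max (f ∘ suc) in
      f zero ℕ.⊔ n , λ { zero → ℕ.m≤m⊔n (f zero) n ; (suc i) → ℕ.≤-trans (f≤ i) (ℕ.m≤n⊔m (f zero) n) }

    record Split {n} (a : Labelling n) (D : Pred Cantor 0ℓ) {k} (f : Fin k → Fin n) (v : Fin k → C) : Set₁ where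
      field
        piece     : Fin k → Pred Cantor 0ℓ
        piece-loc : ∀ j → Loc (piece j)
        piece⊆    : ∀ j x → x ∈ piece j → x ∈ D × label a x ≡ f j
        disjoint  : ∀ {i j x} → x ∈ piece i → x ∈ piece j → i ≡ j
        covers    : ∀ x → x ∈ D → ∃[ j ] x ∈ piece j
        content   : ∀ j → m (piece-loc j) ≋ v j
    open Split

    -- Induction on the number of pieces: piece 0 is cut out of its block by `split`, and the others
    -- are found in what remains of D. With no pieces left every block has content 0, and fullness
    -- makes D empty.
    splitting : ∀ {n} (a : Labelling n) {D} (d : Loc D) {k} (f : Fin k → Fin n) (v : Fin k → C) →
      (∀ j → v j ∈ Val) → (∀ i → m (loc-∩ d (at a i)) ≋ fibreSum f i v) → Split a D f v
    splitting a d {zero} f v v∈ m≋ = record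
      { piece = λ () ; piece-loc = λ () ; piece⊆ = λ () ; disjoint = λ { {()} } ; content = λ ()
      ; covers = λ x x∈D → ⊥-elim (m-full (loc-∩ d (at a (label a x))) (m≋ (label a x)) x (x∈D , ≡.refl)) }
    splitting {n} a {D} d {suc k} f v v∈ m≋ = record
      { piece     = pieces
      ; piece-loc = λ { zero → w ; (suc j) → piece-loc rest j }
      ; piece⊆    = λ { zero x x∈W → W⊆ x∈W
                      ; (suc j) x x∈ → let (x∈D , _) , ax≡ = piece⊆ rest j x x∈ in x∈D , ax≡ }
      ; disjoint  = λ { {zero}  {zero}  _ _ → ≡.refl
                      ; {zero}  {suc j} x∈W x∈ → ⊥-elim (proj₂ (proj₁ (piece⊆ rest j _ x∈)) x∈W)
                      ; {suc i} {zero}  x∈ x∈W → ⊥-elim (proj₂ (proj₁ (piece⊆ rest i _ x∈)) x∈W)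
                      ; {suc i} {suc j} x∈ x∈′ → ≡.cong suc (disjoint rest x∈ x∈′) }
      ; covers    = cover
      ; content   = λ { zero → m-w ; (suc j) → content rest j }
      }
      where
      -- The values destined for the block of piece 0, and 0 elsewhere, so that `v zero` plus their
      -- sum is the fibre sum over `f zero`.
      others : Fin k → C
      others j = if does (f (suc j) Fin.≟ f zero) then v (suc j) else 0#
      others∈ : ∀ j → others j ∈ Val
      others∈ j with does (f (suc j) Fin.≟ f zero)
      ... | true  = v∈ (suc j)
      ... | false = 0∈Val
      first = split (loc-∩ d (at a (f zero))) (v zero) others (v∈ zero) others∈
        (trans (m≋ (f zero)) (∙-congʳ (reflexive (≡.cong (λ b → if b then v zero else 0#)
          (dec-true (f zero Fin.≟ f zero) ≡.refl)))))
      W = proj₁ first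
      w = proj₁ (proj₂ first)
      W⊆ = proj₁ (proj₂ (proj₂ first))
      m-w = proj₂ (proj₂ (proj₂ first))
      D′ : Pred Cantor 0ℓ
      D′ = D ∩ ∁ W
      d′ : Loc D′
      d′ = loc-∩ d (loc-∁ w)
      remove : ∀ i → m (loc-∩ d (at a i)) ≋ (if does (f zero Fin.≟ i) then v zero else 0#) + m (loc-∩ d′ (at a i))
      remove i with f zero Fin.≟ i
      ... | yes ≡.refl = trans
              (m-∪ w (loc-∩ d′ (at a i)) (loc-∩ d (at a i)) (λ (x∈W , (_ , x∉W) , _) → x∉W x∈W)
                ((λ {x} → decide x) , ⊎.[ W⊆ , (λ ((x∈D , _) , ax≡i) → x∈D , ax≡i) ]))
              (∙-congʳ m-w)
        where
        decide : ∀ x → x ∈ D ∩ (label a ⊢ (_≡ f zero)) → x ∈ W ∪ D′ ∩ (label a ⊢ (_≡ f zero))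
        decide x (x∈D , ax≡) with lem {P = x ∈ W}
        ... | yes x∈W = inj₁ x∈W
        ... | no  x∉W = inj₂ ((x∈D , x∉W) , ax≡)
      ... | no f0≢i = trans
              (m-cong (loc-∩ d (at a i)) (loc-∩ d′ (at a i))
                ( (λ (x∈D , ax≡i) → (x∈D , λ x∈W → f0≢i (≡.trans (≡.sym (proj₂ (W⊆ x∈W))) ax≡i)) , ax≡i)
                , λ ((x∈D , _) , ax≡i) → x∈D , ax≡i))
              (sym (identityˡ _))
      rest : Split a D′ (f ∘ suc) (v ∘ suc)
      rest = splitting a d′ (f ∘ suc) (v ∘ suc) (v∈ ∘ suc) λ i →
        ∙-cancelˡ (if does (f zero Fin.≟ i) then v zero else 0#) _ _ (trans (sym (remove i)) (m≋ i))
      pieces : Fin (suc k) → Pred Cantor 0ℓ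
      pieces zero    = W
      pieces (suc j) = piece rest j
      cover : ∀ x → x ∈ D → ∃[ j ] x ∈ pieces j
      cover x x∈D with lem {P = x ∈ W}
      ... | yes x∈W = zero , x∈W
      ... | no  x∉W = let j , x∈ = covers rest x (x∈D , x∉W) in suc j , x∈

    split-labelling : ∀ {n k} (a : Labelling n) (f : Fin k → Fin n) (v : Fin k → C) →
      (∀ j → v j ∈ Val) → (∀ i → wt a i ≋ fibreSum f i v) →
      Σ[ b ∈ Labelling k ] (f ∘ label b ≗ label a × (∀ j → wt b j ≋ v j))
    split-labelling a f v v∈ wt≋ = b , (λ x → ≡.sym (proj₂ (piece⊆ S (label b x) x (in-piece x)))) , λ j →
        trans (m-cong (at b j) (piece-loc S j)
          ( (λ { {x} ≡.refl → in-piece x }) , λ {x} x∈ → disjoint S (in-piece x) x∈))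
          (content S j)
      where
      S = splitting a loc-U f v v∈ λ i → trans (m-cong _ _ (proj₂ , (_ ,_))) (wt≋ i)
      in-piece : ∀ x → x ∈ piece S (proj₁ (covers S x _))
      in-piece x = proj₂ (covers S x _)
      b = labelling (λ x → proj₁ (covers S x _)) (proj₁ (max (depth ∘ piece-loc S))) λ {x} {y} x≡y →
        disjoint S (resp (piece-loc S _) (≡[]-mono (proj₂ (max (depth ∘ piece-loc S)) _) x≡y) (in-piece x)) (in-piece y)

    record JointSplit {n k} (a b : Labelling n) (f : Fin k → Fin n) (e : Fin k → Fin k → C) : Set where
      field
        fst snd : Labelling k
        f∘fst   : f ∘ label fst ≗ label a
        f∘snd   : f ∘ label snd ≗ label b
        joint-e : ∀ p q → joint fst snd p q ≋ e p q

      -- Rows sum to the weights of `fst` and columns to those of `snd`. This is where the balance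
      -- of a matrix enters: it lets a homeomorphism carry one labelling to the other.
      same-wt : (∀ p → sum (λ q → e p q) ≋ sum (λ q → e q p)) → ∀ p → wt snd p ≋ wt fst p
      same-wt balanced p = begin
        wt snd p                         ≈⟨ joint-col fst snd p ⟨
        sum (λ q → joint fst snd q p)    ≈⟨ sum-cong-≋ (λ q → joint-e q p) ⟩
        sum (λ q → e q p)                ≈⟨ balanced p ⟨
        sum (λ q → e p q)                ≈⟨ sum-cong-≋ (λ q → joint-e p q) ⟨
        sum (λ q → joint fst snd p q)    ≈⟨ joint-row fst snd p ⟩
        wt fst p                         ∎

    -- The matrix e is read as a weight vector on pairs of labels, and `⟨ a , b ⟩` is split along f
    -- × f; the coordinates of the result are `fst` and `snd`.
    split-joint : ∀ {n k} (a b : Labelling n) (f : Fin k → Fin n) (e : Fin k → Fin k → C) →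
      (∀ p q → e p q ∈ Val) → (∀ i j → joint a b i j ≋ fibreSum f i (λ p → fibreSum f j (e p))) →
      JointSplit a b f e
    split-joint {n} {k} a b f e e∈ joint≋ = record
      { fst = c ; snd = d
      ; f∘fst = λ x → Fin.combine-injectiveˡ (f (label c x)) (f (label d x)) (label a x) (label b x) (F∘cd≗ab x)
      ; f∘snd = λ x → Fin.combine-injectiveʳ (f (label c x)) (f (label d x)) (label a x) (label b x) (F∘cd≗ab x)
      ; joint-e = λ p q → begin
          joint c d p q           ≈⟨ m-cong (loc-∩ (at c p) (at d q)) (at cd (combine p q)) ((λ {x} → to x) , λ {x} → from x) ⟩
          wt cd (combine p q)     ≈⟨ wt-cd (combine p q) ⟩
          v (combine p q)         ≈⟨ reflexive (v-combine p q) ⟩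
          e p q                   ∎ }
      where
      F : Fin (k ℕ.* k) → Fin (n ℕ.* n)
      F i = combine (f (proj₁ (remQuot {k} k i))) (f (proj₂ (remQuot {k} k i)))
      v : Fin (k ℕ.* k) → C
      v i = e (proj₁ (remQuot {k} k i)) (proj₂ (remQuot {k} k i))
      v-combine : ∀ p q → v (combine p q) ≡ e p q
      v-combine p q = ≡.cong (λ i → e (proj₁ i) (proj₂ i)) (Fin.remQuot-combine p q)
      F-combine : ∀ p q → F (combine p q) ≡ combine (f p) (f q)
      F-combine p q = ≡.cong (λ i → combine (f (proj₁ i)) (f (proj₂ i))) (Fin.remQuot-combine p q)
      wt≋ : ∀ i → wt ⟨ a , b ⟩ i ≋ fibreSum F i v
      wt≋ i with Fin.combine-surjective {n} {n} i
      ... | p , q , ≡.refl = begin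
        wt ⟨ a , b ⟩ (combine p q)                    ≈⟨ wt-⟨⟩ a b p q ⟩
        joint a b p q                                 ≈⟨ joint≋ p q ⟩
        fibreSum f p (λ p → fibreSum f q (e p))
          ≈⟨ fibreSum-cong f p (λ p → fibreSum-cong f q (λ q → reflexive (v-combine p q))) ⟨
        fibreSum f p (λ p → fibreSum f q (λ q → v (combine p q)))
          ≈⟨ fibreSum-combine f f F F-combine v p q ⟨
        fibreSum F (combine p q) v                    ∎
      S = split-labelling ⟨ a , b ⟩ F v (λ i → e∈ _ _) wt≋
      cd = proj₁ S
      F∘cd≗ab = proj₁ (proj₂ S)
      wt-cd = proj₂ (proj₂ S)
      c = mapˡ (λ i → proj₁ (remQuot {k} k i)) cd
      d = mapˡ (λ i → proj₂ (remQuot {k} k i)) cd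
      to : ∀ x {p q} → label c x ≡ p × label d x ≡ q → label cd x ≡ combine p q
      to x (≡.refl , ≡.refl) = ≡.sym (Fin.combine-remQuot {k} k (label cd x))
      from : ∀ x {p q} → label cd x ≡ combine p q → label c x ≡ p × label d x ≡ q
      from x {p} {q} eq = ≡.cong proj₁ both , ≡.cong proj₂ both
        where both = ≡.trans (≡.cong (remQuot {k} k) eq) (Fin.remQuot-combine p q)

    -- A finite approximation of a homeomorphism: the left block i is meant to go onto the right
    -- block i.
    record Matching : Set where
      constructor matching
      field
        {size}     : ℕ
        left right : Labelling size
        same       : ∀ i → wt left i ≋ wt right i
    open Matching public

    flip : Matching → Matching
    flip M = matching (right M) (left M) (λ i → sym (same M i))

    Refines : Matching → Matching → Set
    Refines N M = ∃[ π ] (π ∘ label (left N) ≗ label (left M) × π ∘ label (right N) ≗ label (right M))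

    Fine : ∀ {k} → ℕ → Labelling k → Set
    Fine n a = ∀ {x y} → label a x ≡ label a y → x ≡[ n ] y

    -- The left side is cut by bits at will; the right side can follow because the new weights are
    -- clopen values and add up to the old ones.
    refine-left : ∀ M n → Σ[ N ∈ Matching ] (Refines N M × Fine n (left N))
    refine-left M@(matching {k} a b same) n = matching a′ b′ (λ i → sym (wt-b′ i)) , (π , π∘a′≗a , π∘b′≗b) , λ {x} {y} eq →
        firstBits-injective n (Fin.combine-injectiveʳ (label a x) (label (firstBits n) x) (label a y) _ eq)
      where
      a′ = ⟨ a , firstBits n ⟩
      π = λ i → proj₁ (remQuot {k} (2 ℕ.^ n) i)
      π∘a′≗a : π ∘ label a′ ≗ label a
      π∘a′≗a x = ≡.cong proj₁ (Fin.remQuot-combine (label a x) (label (firstBits n) x))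
      S = split-labelling b π (wt a′) (λ j → m∈Val (at a′ j)) (λ i → trans (sym (same i)) (wt-fibre a′ a π π∘a′≗a i))
      b′ = proj₁ S
      π∘b′≗b = proj₁ (proj₂ S)
      wt-b′ = proj₂ (proj₂ S)

    refine : ∀ M n → Σ[ N ∈ Matching ] (Refines N M × Fine n (left N) × Fine n (right N))
    refine M n =
      let N , (π , πl , πr) , fineˡ = refine-left M n
          O , (ρ , ρl , ρr) , fineʳ = refine-left (flip N) n
      in flip O ,
         (π ∘ ρ , (λ x → ≡.trans (≡.cong π (ρr x)) (πl x)) , λ x → ≡.trans (≡.cong π (ρl x)) (πr x)) ,
         (λ {x} {y} eq → fineˡ (≡.trans (≡.sym (ρr x)) (≡.trans (≡.cong ρ eq) (ρr y)))) , fineʳ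

-- Injective coding of finite data by natural numbers

module Codes where
  open ≡ using (refl; sym; cong; cong₂)

  double : ℕ → ℕ
  double zero    = zero
  double (suc n) = suc (suc (double n))

  double-injective : Injective _≡_ _≡_ double
  double-injective {zero}  {zero}  eq = refl
  double-injective {suc m} {suc n} eq = cong suc (double-injective (ℕ.suc-injective (ℕ.suc-injective eq)))

  double≢1+double : ∀ m n → double m ≢ suc (double n)
  double≢1+double (suc m) n eq = double≢1+double n m (sym (ℕ.suc-injective eq))

  -- 2 ^ m * (1 + 2 * n)
  code₂ : ℕ → ℕ → ℕ
  code₂ zero    n = suc (double n)
  code₂ (suc m) n = double (code₂ m n)

  code₂-injective : ∀ m n m′ n′ → code₂ m n ≡ code₂ m′ n′ → m ≡ m′ × n ≡ n′
  code₂-injective zero    n zero     n′ eq = refl , double-injective (ℕ.suc-injective eq)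
  code₂-injective zero    n (suc m′) n′ eq = ⊥-elim (double≢1+double (code₂ m′ n′) n (sym eq))
  code₂-injective (suc m) n zero     n′ eq = ⊥-elim (double≢1+double (code₂ m n) n′ eq)
  code₂-injective (suc m) n (suc m′) n′ eq with code₂-injective m n m′ n′ (double-injective eq)
  ... | refl , n≡n′ = refl , n≡n′

  -- The length is not coded; injectivity is for fixed k, and `code` stores the lengths separately.
  codeVec : ∀ {a} {A : Set a} {k} → (A → ℕ) → Vec A k → ℕ
  codeVec f []       = 0
  codeVec f (x ∷ xs) = code₂ (f x) (codeVec f xs)

  codeVec-injective : ∀ {a} {A : Set a} {f : A → ℕ} → Injective _≡_ _≡_ f → ∀ {k} → Injective _≡_ _≡_ (codeVec {k = k} f)
  codeVec-injective f-inj {x = []}     {[]}     eq = refl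
  codeVec-injective {f = f} f-inj {x = x ∷ xs} {y ∷ ys} eq with code₂-injective (f x) _ (f y) _ eq
  ... | fx≡fy , eq′ = cong₂ _∷_ (f-inj fx≡fy) (codeVec-injective f-inj eq′)

-- Homeomorphisms as limits of matchings

module Construction (lem : ∀ {ℓ} → ExcludedMiddle ℓ) (V : Pred Defs.ℝ 0ℓ) (V-groupLike : Defs.GroupLike V)
  (M : Defs.Measure) (good : Defs.Good M) (values≐V : Defs.ClopenValues M ≐ V) where

  open Defs
  open Reals
  open CantorSpace
  open CantorSpace.Compactness lem
  open MeasureTheory lem
  open Labellings lem
  open Codes

  open Measure M
  open GroupLike V-groupLike using (0∈V; V⊆[0,1])

  massᴸ : ∀ {U} → Loc U → ℝ
  massᴸ u = μᶜ (loc⇒clopen u)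

  -- v is a clopen value. Either the remainder is positive, which gives the strict inequality that
  -- goodness demands, or it vanishes and U itself serves.
  massᴸ-split : ∀ {n U} (u : Loc U) v (f : Fin n → ℝ) → v ∈ V → (∀ i → f i ∈ V) → massᴸ u ≈ v + sum f →
                ∃[ W ] Σ[ w ∈ Loc W ] (W ⊆ U × massᴸ w ≈ v)
  massᴸ-split {U = U} u v f v∈V f∈V u≈ with lem {P = 0ℝ < sum f}
  ... | yes 0<s =
    let _ , c , c≈v = proj₂ values≐V v∈V
        c<u = ≤-<-trans (≤-reflexive c≈v) (<-≤-trans (x<x+y v 0<s) (≤-reflexive (ℝ-group.sym u≈)))
        W , w , W⊆U , w≈c = Good.subset good c (loc⇒clopen u) c<u
    in W , clopen⇒loc w , W⊆U ,
       ℝ-group.trans (μ-cong (loc⇒borel (clopen⇒loc w)) (clopen⇒borel w) (id , id)) (ℝ-group.trans w≈c c≈v)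
  ... | no 0≮s = U , u , id , ℝ-group.trans u≈ (ℝ-group.trans (+-congˡ v s≈0) (+-identityʳ v))
    where
    s≈0 : sum f ≈ 0ℝ
    s≈0 = ≤-antisym (≮⇒≥ 0≮s) (sum-nonNeg f (proj₁ ∘ V⊆[0,1] ∘ f∈V))

  content : Content
  content = record
    { values = ℝ-abelianGroup
    ; m      = massᴸ
    ; m-cong = λ u w → μ-cong (loc⇒borel u) (loc⇒borel w)
    ; m-∪    = λ u w z → μ-∪ M (loc⇒borel u) (loc⇒borel w) (loc⇒borel z)
    ; m-∅    = λ u x∉U → ℝ-group.trans
        (μ-cong (loc⇒borel u) borel-∅ ((λ {x} → x∉U x) , λ ())) (μ-∅ M)
    ; m-full = λ u u≈0 x x∈U → <-irrefl (<-≤-trans (Good.full good (loc⇒open u) (x , x∈U)) (≤-reflexive u≈0))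
    ; Val    = V
    ; 0∈Val  = 0∈V
    ; m∈Val  = λ u → proj₁ values≐V (_ , loc⇒clopen u , ℝ-group.refl)
    ; split  = massᴸ-split
    }

  open Combinatorics content

  UniformlyContinuous : (Cantor → Cantor) → Set
  UniformlyContinuous f = ∀ n → ∃[ m ] (∀ {x y} → x ≡[ m ] y → f x ≡[ n ] f y)

  uniform⇒continuous : ∀ {f} → UniformlyContinuous f → Continuous f
  uniform⇒continuous f-uc o = cylinder⇒open λ fx∈U →
    let n , ⊆U = open⇒cylinder o fx∈U
        m , x≡⇒ = f-uc n
    in m , λ x≡y → ⊆U (x≡⇒ x≡y)

  uniform⇒cong : ∀ {f} → UniformlyContinuous f → ∀ {x y} → x ≗ y → f x ≗ f y
  uniform⇒cong f-uc x≗y = ≡[]⇒≗ λ n → proj₂ (f-uc n) (≗⇒≡[] x≗y)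

  mkHomeo : ∀ {to from} → UniformlyContinuous to → UniformlyContinuous from →
            (∀ y → to (from y) ≗ y) → (∀ x → from (to x) ≗ x) →
            (∀ {U} (u : Loc U) (p : Loc (to ⊢ U)) → massᴸ p ≈ massᴸ u) → Homeo M
  mkHomeo {to} {from} to-uc from-uc to∘from from∘to preserved = record
    { bijection = record
      { to = to ; from = from
      ; to-cong = uniform⇒cong to-uc ; from-cong = uniform⇒cong from-uc
      ; inverse = (λ {y} x≗ i → ≡.trans (uniform⇒cong to-uc x≗ i) (to∘from y i))
                , (λ {x} y≗ i → ≡.trans (uniform⇒cong from-uc y≗ i) (from∘to x i)) }
    ; to-continuous   = λ {U} → to-cts {U}
    ; from-continuous = uniform⇒continuous from-uc
    ; preserves       = borel-agree (push-forward M (λ {U} → to-cts {U})) M λ u →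
        ℝ-group.trans (μ-cong _ _ (id , id))
          (preserved u (clopen⇒loc (to-cts (loc⇒open u) , to-cts (loc⇒open (loc-∁ u)))))
    }
    where
    to-cts : Continuous to
    to-cts = uniform⇒continuous to-uc

  module _ (h : Homeo M) where
    open Homeo h

    to-uniform : UniformlyContinuous to
    to-uniform = uniform to-continuous

    from-uniform : UniformlyContinuous from
    from-uniform = uniform from-continuous

    pull : ∀ {k} → Labelling k → Labelling k
    pull a = labelling (label a ∘ to) (proj₁ (to-uniform (ldepth a))) λ x≡y →
      lresp a (proj₂ (to-uniform (ldepth a)) x≡y)

    m-pull : ∀ {U} (u : Loc U) (p : Loc (to ⊢ U)) → massᴸ p ≈ massᴸ u
    m-pull u p = ℝ-group.trans
      (μ-cong (loc⇒borel p) (borel-preimage to-continuous (loc⇒borel u)) (id , id))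
      (preserves (loc⇒borel u))

  -- `label (left N) x ≡ label (right N) y` says that y is a possible image of x; the candidate sets
  -- of N lie inside those of N′. This also makes sense when the stages come from different
  -- homeomorphisms, as in `baire`.
  Coherent : Matching → Matching → Set
  Coherent N N′ = ∀ x y → label (left N) x ≡ label (right N) y → label (left N′) x ≡ label (right N′) y

  module Limit (N : ℕ → Matching) (coherent : ∀ n → Coherent (N (suc n)) (N n))
    (fine : ∀ n → Fine n (left (N n)) × Fine n (right (N n))) where

    module OneSided (N : ℕ → Matching) (coherent : ∀ n → Coherent (N (suc n)) (N n))
      (fine : ∀ n → Fine n (right (N n))) where

      coherent-≤ : ∀ {m n} → m ℕ.≤ n → Coherent (N n) (N m)
      coherent-≤ m≤n = go (ℕ.≤⇒≤′ m≤n)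
        where
        go : ∀ {m n} → m ℕ.≤′ n → Coherent (N n) (N m)
        go (ℕ.≤′-reflexive ≡.refl) x y = id
        go (ℕ.≤′-step {n} m≤n) x y = go m≤n x y ∘ coherent n x y

      -- The left block contains x, so fullness makes its weight nonzero; the right block has the
      -- same weight and is therefore nonempty.
      witness : ∀ n x → ∃[ y ] label (right (N n)) y ≡ label (left (N n)) x
      witness n x = wt-∃ (right (N n)) λ wt≈0 →
        wt-label (left (N n)) x (ℝ-group.trans (same (N n) (label (left (N n)) x)) wt≈0)

      to : Cantor → Cantor
      -- Right blocks of stage `suc i` determine bit i, and coherence preserves it at later stages.
      to x i = proj₁ (witness (suc i) x) i

      to-witness : ∀ n x → to x ≡[ n ] proj₁ (witness n x)
      to-witness n x {i} i<n = fine (suc i)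
        (≡.trans (proj₂ (witness (suc i) x)) (coherent-≤ i<n x _ (≡.sym (proj₂ (witness n x))))) ℕ.≤-refl

      to-label : ∀ n x → label (right (N n)) (to x) ≡ label (left (N n)) x
      -- The right labelling of stage n reads d bits, on which `to x` agrees with the witness of
      -- stage `n ⊔ d`; coherence brings the label of that witness down to stage n.
      to-label n x = ≡.sym (≡.trans
        (coherent-≤ (ℕ.m≤m⊔n n d) x (proj₁ (witness (n ⊔ d) x)) (≡.sym (proj₂ (witness (n ⊔ d) x))))
        (lresp (right (N n)) (≡[]-sym (≡[]-⊔ʳ n d (to-witness (n ⊔ d) x)))))
        where d = ldepth (right (N n))

      to-uc : UniformlyContinuous to
      to-uc n = ldepth (left (N n)) , λ {x} {y} x≡y →
        fine n (≡.trans (to-label n x) (≡.trans (lresp (left (N n)) x≡y) (≡.sym (to-label n y))))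

    open OneSided N coherent (proj₂ ∘ fine) public
    private module Inverse = OneSided (flip ∘ N) (λ n x y eq → ≡.sym (coherent n y x (≡.sym eq))) (proj₁ ∘ fine)

    limit : Homeo M
    limit = mkHomeo to-uc Inverse.to-uc
      (λ y → ≡[]⇒≗ λ n → proj₂ (fine n) (≡.trans (to-label n (Inverse.to y)) (Inverse.to-label n y)))
      (λ x → ≡[]⇒≗ λ n → proj₁ (fine n) (≡.trans (Inverse.to-label n (to x)) (to-label n x)))
      preserved
      where
      -- At stage `depth u`, U is a union of right blocks and its preimage is the union of the left
      -- blocks with the same labels.
      preserved : ∀ {U} (u : Loc U) (p : Loc (to ⊢ U)) → massᴸ p ≈ massᴸ u
      preserved {U} u p = ℝ-group.trans (μ-cong (loc⇒borel p) (loc⇒borel (loc-label a P)) ((λ {x} → p⊆ x) , λ {x} → ⊆p x))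
        (ℝ-group.trans (m-label a b (same (N (depth u))) P)
          (μ-cong (loc⇒borel (loc-label b P)) (loc⇒borel u) ((λ {x} → ⊆u x) , λ {x} x∈ → x , x∈ , ≡.refl)))
        where
        a = left (N (depth u))
        b = right (N (depth u))
        P : Pred (Fin _) 0ℓ
        P j = ∃[ y ] (y ∈ U × label b y ≡ j)
        ⊆u : ∀ x → P (label b x) → x ∈ U
        ⊆u x (y , y∈U , eq) = resp u (proj₂ (fine (depth u)) eq) y∈U
        p⊆ : ∀ x → to x ∈ U → P (label a x)
        p⊆ x tx∈U = to x , tx∈U , to-label (depth u) x
        ⊆p : ∀ x → P (label a x) → to x ∈ U
        ⊆p x (y , y∈U , eq) = resp u (proj₂ (fine (depth u)) (≡.trans eq (≡.sym (to-label (depth u) x)))) y∈U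

  open Homeo using (to; from)

  -- Back and forth: both sides are refined to ever finer blocks, and the limit respects every
  -- stage. The given matching can be stage 0 because `Fine 0` is vacuous.
  homogeneous : ∀ N → Σ[ h ∈ Homeo M ] (label (right N) ∘ to h ≗ label (left N))
  homogeneous N = limit , to-label 0
    where
    stage : ℕ → Matching
    stage zero    = N
    stage (suc n) = proj₁ (refine (stage n) (suc n))

    coherent : ∀ n → Coherent (stage (suc n)) (stage n)
    coherent n x y eq =
      let π , πˡ , πʳ = proj₁ (proj₂ (refine (stage n) (suc n)))
      in ≡.trans (≡.sym (πˡ x)) (≡.trans (≡.cong π eq) (πʳ y))

    fine : ∀ n → Fine n (left (stage n)) × Fine n (right (stage n))
    fine zero    = (λ _ ()) , (λ _ ())
    fine (suc n) = proj₂ (proj₂ (refine (stage n) (suc n)))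

    open Limit stage coherent fine

  -- Uniform closeness and the Baire category theorem

  Near : ℕ → Homeo M → Homeo M → Set
  Near n g h = ∀ x → to h x ≡[ n ] to g x

  near-refl : ∀ {n} g → Near n g g
  near-refl g x _ = ≡.refl

  near-trans : ∀ {n f g h} → Near n f g → Near n g h → Near n f h
  near-trans f~g g~h x = ≡[]-trans (g~h x) (f~g x)

  near-mono : ∀ {m n g h} → m ℕ.≤ n → Near n g h → Near m g h
  near-mono m≤n g~h x = ≡[]-mono m≤n (g~h x)

  -- The points g (h⁻¹ y) and y = h (h⁻¹ y) are close when h is near g, and the modulus of g⁻¹
  -- applies to them.
  inverse-near : ∀ g n → ∃[ N ] (∀ h → Near N g h → ∀ y → from h y ≡[ n ] from g y)
  inverse-near g n = let N , x≡⇒ = from-uniform g n in N , λ h g~h y →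
    ≡[]-trans (≗⇒≡[] (λ i → ≡.sym (Homeo.strictlyInverseʳ g (from h y) i)))
      (x≡⇒ (≡[]-trans (≡[]-sym (g~h (from h y))) (≗⇒≡[] (Homeo.strictlyInverseˡ h y))))

  -- The centres of a nested sequence of balls are turned into matchings, so that `Limit` delivers
  -- their limit as a measure preserving homeomorphism.
  baire : ∀ {ℓ} (D : ℕ → Pred (Homeo M) ℓ) →
    (∀ n g N → Σ[ h ∈ Homeo M ] (Near N g h × ∃[ N′ ] (∀ k → Near N′ h k → k ∈ D n))) →
    Σ[ g ∈ Homeo M ] (∀ n → g ∈ D n)
  baire D dense = limit , λ n → within-D n limit (near-limit (suc n))
    where
    record Stage (n : ℕ) : Set₁ where
      constructor stage
      field
        centre       : Homeo M
        radius       : ℕ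
        n≤radius     : n ℕ.≤ radius
        inverse-close : ∀ h → Near radius centre h → ∀ y → from h y ≡[ n ] from centre y
    open Stage

    next : ∀ n (s : Stage n) → Σ[ s′ ∈ Stage (suc n) ]
      (radius s ℕ.≤ radius s′ × Near (radius s) (centre s) (centre s′) × (∀ h → Near (radius s′) (centre s′) h → h ∈ D n))
    next n s =
      let N = radius s
          h , g~h , N′ , ⊆D = dense n (centre s) N
          N″ , inv = inverse-near h (suc n)
          -- N keeps the balls nested, `suc n` makes the radii grow, `N′` keeps the ball within
          -- `D n`, and `N″` controls inverses to `suc n` bits.
          R = N ⊔ (suc n ⊔ (N′ ⊔ N″))
          b : (suc n ⊔ (N′ ⊔ N″)) ℕ.≤ R
          b = ℕ.m≤n⊔m N (suc n ⊔ (N′ ⊔ N″))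
          c : (N′ ⊔ N″) ℕ.≤ R
          c = ℕ.≤-trans (ℕ.m≤n⊔m (suc n) (N′ ⊔ N″)) b
      in stage h R (ℕ.≤-trans (ℕ.m≤m⊔n (suc n) (N′ ⊔ N″)) b)
           (λ k h~k → inv k (near-mono {g = h} {k} (ℕ.≤-trans (ℕ.m≤n⊔m N′ N″) c) h~k)) ,
         ℕ.m≤m⊔n N _ , g~h ,
         λ k h~k → ⊆D k (near-mono {g = h} {k} (ℕ.≤-trans (ℕ.m≤m⊔n N′ N″) c) h~k)

    stages : ∀ n → Stage n
    stages zero    = stage (idʰ M) 0 ℕ.z≤n (λ _ _ _ ())
    stages (suc n) = proj₁ (next n (stages n))

    within-D : ∀ n h → Near (radius (stages (suc n))) (centre (stages (suc n))) h → h ∈ D n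
    within-D n = proj₂ (proj₂ (proj₂ (next n (stages n))))

    -- The second component controls the inverses, without which the limit need
    -- not be a homeomorphism.
    target : ∀ n → Labelling _
    target n = ⟨ firstBits (radius (stages n)) , labelling (label (firstBits n) ∘ from g) (proj₁ (from-uniform g n))
                   (λ x≡y → lresp (firstBits n) (proj₂ (from-uniform g n) x≡y)) ⟩
      where g = centre (stages n)

    N : ℕ → Matching
    N n = matching (pull g (target n)) (target n) λ i → m-pull g (at (target n) i) (at (pull g (target n)) i)
      where g = centre (stages n)

    target-≡ : ∀ n {x y} → label (target n) x ≡ label (target n) y →
      x ≡[ radius (stages n) ] y × from (centre (stages n)) x ≡[ n ] from (centre (stages n)) y
    target-≡ n {x} {y} eq =
      firstBits-injective (radius (stages n)) (Fin.combine-injectiveˡ (label (firstBits R) x) _ (label (firstBits R) y) _ eq) ,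
      firstBits-injective n (Fin.combine-injectiveʳ (label (firstBits R) x) _ (label (firstBits R) y) _ eq)
      where R = radius (stages n)

    -- Let g and h be the centres of stages n and `suc n`. Equal labels mean that h x is close to y
    -- and x is close to h⁻¹ y. Then g x is close to y, as g and h agree up to the old radius, and x
    -- is close to g⁻¹ y by `inverse-close`.
    coherent : ∀ n → Coherent (N (suc n)) (N n)
    coherent n x y eq = ≡.cong₂ combine
        (lresp (firstBits (radius s)) (≡[]-trans (≡[]-sym (g~h x)) (≡[]-mono R≤ hx≡y)))
        (lresp (firstBits n) (≡[]-trans (≗⇒≡[] (Homeo.strictlyInverseʳ g x))
          (≡[]-trans (≡[]-mono (ℕ.n≤1+n n) (≡[]-trans (≗⇒≡[] (λ i → ≡.sym (Homeo.strictlyInverseʳ h x i))) x≡h⁻¹y))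
            (inverse-close s h g~h y))))
      where
      s = stages n
      g = centre s
      h = centre (stages (suc n))
      R≤ = proj₁ (proj₂ (next n s))
      g~h = proj₁ (proj₂ (proj₂ (next n s)))
      hx≡y = proj₁ (target-≡ (suc n) eq)
      x≡h⁻¹y = proj₂ (target-≡ (suc n) eq)

    fine : ∀ n → Fine n (left (N n)) × Fine n (right (N n))
    fine n = (λ {x} {y} eq → ≡[]-trans (≗⇒≡[] (λ i → ≡.sym (Homeo.strictlyInverseʳ g x i)))
               (≡[]-trans (proj₂ (target-≡ n eq)) (≗⇒≡[] (Homeo.strictlyInverseʳ g y))))
           , λ eq → ≡[]-mono (n≤radius (stages n)) (proj₁ (target-≡ n eq))
      where g = centre (stages n)

    open Limit N coherent fine

    near-limit : ∀ n → Near (radius (stages n)) (centre (stages n)) limit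
    near-limit n x = proj₁ (target-≡ n (to-label n x))

  -- Balls and the compact-open topology

  open Homeo using (to-continuous)

  Ball : ℕ → Homeo M → Pred (Homeo M) (lsuc 0ℓ)
  Ball n g h = Lift _ (Near n g h)

  -- For each value b, h must map the compact set where bit i of g x is b into the set where bit i
  -- is b. Both values together fix bit i of h.
  ball-open : ∀ n g → HomeoOpen M (Ball n g)
  ball-open n g {h} (lift g~h) = indices n , within n {h} g~h , λ {k} k∈ → lift (near n {k} k∈)
    where
    bit-loc : ∀ i b → Loc (λ y → y i ≡ b)
    bit-loc i b = loc (suc i) λ x≡y → ≡.trans (≡.sym (x≡y ℕ.≤-refl))

    index : ℕ → Bool → CompactOpen M
    index i b = ((λ x → to g x i ≡ b) , λ y → y i ≡ b) ,
      clopen⇒compact (to-continuous g (loc⇒open (bit-loc i b)) , to-continuous g (loc⇒open (loc-∁ (bit-loc i b)))) ,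
      loc⇒open (bit-loc i b)

    indices : ℕ → List (CompactOpen M)
    indices zero    = []
    indices (suc n) = index n true ∷ index n false ∷ indices n

    within : ∀ n {h} → Near n g h → All (λ ((K , U) , _) → ∀ {x} → x ∈ K → to h x ∈ U) (indices n)
    within zero    g~h = []
    within (suc n) {h} g~h = (λ {x} → ≡.trans (g~h x ℕ.≤-refl)) ∷ (λ {x} → ≡.trans (g~h x ℕ.≤-refl)) ∷
      within n {h} (λ x → ≡[]-mono (ℕ.n≤1+n n) (g~h x))

    near : ∀ n {h} → All (λ ((K , U) , _) → ∀ {x} → x ∈ K → to h x ∈ U) (indices n) → Near n g h
    near (suc n) {h} (t ∷ f ∷ ts) x {i} i<1+n with ℕ.m≤n⇒m<n∨m≡n (ℕ.s≤s⁻¹ i<1+n)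
    ... | inj₁ i<n = near n {h} ts x i<n
    ... | inj₂ ≡.refl with to g x n in eq
    ...   | true  = t eq
    ...   | false = f eq

  -- The sets `O n`, where the cylinder of length n around h x lies in U, cover K; a finite subcover
  -- gives one n for all of K.
  subbasic-ball : ∀ (((K , U) , _) : CompactOpen M) h → (∀ {x} → x ∈ K → to h x ∈ U) →
                  ∃[ n ] (∀ k → Near n h k → ∀ {x} → x ∈ K → to k x ∈ U)
  subbasic-ball ((K , U) , K-compact , U-open) h h∈ =
    let is , cover = K-compact O O-open λ x∈K →
          let n , ⊆U = open⇒cylinder U-open (h∈ x∈K) in lift n , λ z → ⊆U {z}
        n , ⊆U = uniformly is
    in n , λ k h~k {x} x∈K → ⊆U x (cover x∈K) (≡[]-sym (h~k x))
    where
    O : Lift (lsuc 0ℓ) ℕ → Pred Cantor 0ℓ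
    O (lift n) x = ∀ z → to h x ≡[ n ] z → z ∈ U

    O-open : ∀ i → Open (O i)
    O-open (lift n) = cylinder⇒open λ x∈O → let m , x≡⇒ = to-uniform h n in m , λ x≡y → O-resp x∈O (x≡⇒ x≡y)
      where
      O-resp : ∀ {x y} → x ∈ O (lift n) → to h x ≡[ n ] to h y → y ∈ O (lift n)
      O-resp x∈O x≡y z y≡z = x∈O _ (≡[]-trans x≡y y≡z)

    uniformly : ∀ is → ∃[ n ] (∀ x → Any (λ i → x ∈ O i) is → ∀ {z} → to h x ≡[ n ] z → z ∈ U)
    uniformly []            = 0 , λ _ ()
    uniformly (lift m ∷ is) = let n , ⊆U = uniformly is in m ⊔ n , λ where
      x (here x∈O)   x≡z → x∈O _ (≡[]-⊔ˡ m n x≡z)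
      x (there x∈Os) x≡z → ⊆U x x∈Os (≡[]-⊔ʳ m n x≡z)

  open-ball : ∀ {W} → HomeoOpen M W → ∀ {h} → h ∈ W → ∃[ n ] (∀ k → Near n h k → k ∈ W)
  open-ball W-open {h} h∈W with W-open h∈W
  ... | is , h∈ , ⊆W = let n , near⇒ = balls is h∈ in n , λ k h~k → ⊆W (near⇒ k h~k)
    where
    balls : ∀ is → All (λ ((K , U) , _) → ∀ {x} → x ∈ K → to h x ∈ U) is →
            ∃[ n ] (∀ k → Near n h k → All (λ ((K , U) , _) → ∀ {x} → x ∈ K → to k x ∈ U) is)
    balls []       []       = 0 , λ _ _ → []
    balls (i ∷ is) (h∈ ∷ hs) =
      let m , near⇒  = subbasic-ball i h h∈
          n , near⇒′ = balls is hs
      in m ⊔ n , λ k h~k → near⇒ k (λ x → ≡[]-⊔ˡ m n (h~k x)) ∷ near⇒′ k (λ x → ≡[]-⊔ʳ m n (h~k x))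

  -- Matrices realised by homeomorphisms

  open Homeo using (to-cong; strictlyInverseˡ; strictlyInverseʳ)
  open ClopenPartition using (size)
  open Matrix
  open MatrixMorphism
  open FibreSum ℝ-group.commutativeMonoid using (fibreSum-cong)
  open Category (𝓜 V M) using (_⇒_)

  Mat : Set₁
  Mat = Matrix V M

  dim : Mat → ℕ
  dim A = size (partition A)

  joint-cong : ∀ {k l} (a a′ : Labelling k) (b b′ : Labelling l) → label a ≗ label a′ → label b ≗ label b′ →
               ∀ i j → joint a b i j ≈ joint a′ b′ i j
  joint-cong a a′ b b′ a≗a′ b≗b′ i j = Content.m-cong content (loc-∩ (at a i) (at b j)) (loc-∩ (at a′ i) (at b′ j))
    ( (λ {x} (a≡i , b≡j) → ≡.trans (≡.sym (a≗a′ x)) a≡i , ≡.trans (≡.sym (b≗b′ x)) b≡j)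
    , λ {x} (a≡i , b≡j) → ≡.trans (a≗a′ x) a≡i , ≡.trans (b≗b′ x) b≡j)

  wt-pull : ∀ {k} g (a : Labelling k) i → wt (pull g a) i ≈ wt a i
  wt-pull g a i = m-pull g (at a i) (at (pull g a) i)

  -- B is treated as an abstract matrix: b chooses a place for its indices, possibly away from the
  -- blocks of `partition B`.
  Realises : (g : Homeo M) (B : Mat) → Labelling (dim B) → Set
  Realises g B b = ∀ p q → joint b (pull g b) p q ≈ entry B p q

  realises-wt : ∀ {g B b} → Realises g B b → ∀ p → wt b p ≈ weight V M (partition B) p
  realises-wt {g} {B} {b} real p = ℝ-group.trans (ℝ-group.sym (joint-row b (pull g b) p))
    (ℝ-group.trans (∑.sum-cong-≋ {_} {λ q → joint b (pull g b) p q} {λ q → entry B p q} (real p)) (row-sum B p))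

  realises-surjective : ∀ {g B b} → Realises g B b → ∀ p → ∃[ x ] label b x ≡ p
  realises-surjective {g} {B} {b} real p = wt-∃ b λ wt≈0 → <-irrefl (<-≤-trans
    (Good.full good (proj₁ (ClopenPartition.clopen (partition B) p)) (ClopenPartition.nonempty (partition B) p))
    (≤-reflexive (ℝ-group.trans (ℝ-group.sym (realises-wt {g} {B} {b} real p)) wt≈0)))

  Surjectiveᴸ : ∀ {k} → Labelling k → Set
  Surjectiveᴸ a = ∀ i → ∃[ x ] label a x ≡ i

  matrix : ∀ {k} (g : Homeo M) (a : Labelling k) → Surjectiveᴸ a → Mat
  matrix {k} g a a-onto = record
    { partition = record
      { size     = k
      ; block    = λ i → label a ⊢ (_≡ i)
      ; clopen   = λ i → loc⇒clopen (at a i)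
      ; nonempty = a-onto
      ; disjoint = λ i≢j (≡i , ≡j) → i≢j (≡.trans (≡.sym ≡i) ≡j)
      ; covers   = λ x → label a x , ≡.refl }
    ; entry   = joint a (pull g a)
    ; entry∈V = λ i j → Content.m∈Val content (loc-∩ (at a i) (at (pull g a) j))
    ; row-sum = joint-row a (pull g a)
    ; col-sum = λ i → ℝ-group.trans (joint-col a (pull g a) i) (wt-pull g a i)
    }

  coarsening : ∀ {k g} {c : Labelling k} (c-onto : Surjectiveᴸ c) {B b} → Realises g B b →
               (r : Fin k → Fin (dim B)) → r ∘ label c ≗ label b → matrix g c c-onto ⇒ B
  coarsening {g = g} {c} c-onto {B} {b} real r r∘c≗b = record
    { map        = r
    ; isMorphism = record
      { surjective = λ p → let x , bx≡p = realises-surjective {g} {B} {b} real p in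
          label c x , λ { ≡.refl → ≡.trans (r∘c≗b x) bx≡p }
      ; weights    = λ p → ℝ-group.trans (ℝ-group.sym (realises-wt {g} {B} {b} real p)) (wt-fibre c b r r∘c≗b p) }
    ; entries    = λ p q → ℝ-group.trans (ℝ-group.sym (real p q))
        (joint-fibre c (pull g c) b (pull g b) r r r∘c≗b (r∘c≗b ∘ to g) p q)
    }

  realises-map : ∀ {g C B c} → Realises g C c → (s : C ⇒ B) → Realises g B (mapˡ (map s) c)
  realises-map {g} {C} {B} {c} real s p q = ℝ-group.trans
    (joint-fibre c (pull g c) (mapˡ (map s) c) (pull g (mapˡ (map s) c)) (map s) (map s) (λ _ → ≡.refl) (λ _ → ≡.refl) p q)
    (ℝ-group.trans
      (fibreSum-cong (map s) p (λ i → fibreSum-cong (map s) q (λ j → real i j)))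
      (ℝ-group.sym (entries s p q)))

  -- The labelling reads finitely many bits of the image point, so `Realises` is an open condition
  -- on the homeomorphism.
  realises-near : ∀ {g h k} {b : Labelling k} → Near (ldepth b) g h →
                  ∀ p q → joint b (pull h b) p q ≈ joint b (pull g b) p q
  realises-near {g} {h} {b = b} g~h =
    joint-cong b b (pull h b) (pull g b) (λ _ → ≡.refl) (λ x → lresp b (g~h x))

  -- The pair a, a ∘ g is split along f into `fst` and `snd` with the entries of B as joint weights,
  -- and h is chosen with fst ∘ h = snd. Applying f to this equation gives a ∘ h = a ∘ g.
  realise : ∀ {k} g (a : Labelling k) a-onto {B} (f : B ⇒ matrix g a a-onto) →
    Σ[ h ∈ Homeo M ] Σ[ b ∈ Labelling (dim B) ]
      (map f ∘ label b ≗ label a × Realises h B b × label a ∘ to h ≗ label a ∘ to g)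
  realise {k} g a a-onto {B} f =
    h , fst S , f∘fst S ,
    (λ p q → ℝ-group.trans (joint-cong (fst S) (fst S) (pull h (fst S)) (snd S) (λ _ → ≡.refl) h-fst p q) (joint-e S p q)) ,
    λ x → ≡.trans (≡.sym (f∘fst S (to h x))) (≡.trans (≡.cong (map f) (h-fst x)) (f∘snd S x))
    where
    open JointSplit
    S : JointSplit a (pull g a) (map f) (entry B)
    S = split-joint a (pull g a) (map f) (entry B) (entry∈V B) (entries f)
    H = homogeneous (matching (snd S) (fst S) (same-wt S λ p → ℝ-group.trans (row-sum B p) (ℝ-group.sym (col-sum B p))))
    h = proj₁ H
    h-fst : label (fst S) ∘ to h ≗ label (snd S)
    h-fst = proj₂ H

  firstBits-near : ∀ n {g h} → label (firstBits n) ∘ to h ≗ label (firstBits n) ∘ to g → Near n g h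
  firstBits-near n eq x = firstBits-injective n (eq x)

  factor : ∀ {k} n (a : Labelling k) → ldepth a ℕ.≤ n → ∃[ r ] r ∘ label (firstBits n) ≗ label a
  factor n a d≤n = (λ i → label a (proj₁ (firstBits-surjective n i))) , λ x →
    lresp a (≡[]-mono d≤n (firstBits-injective n (proj₂ (firstBits-surjective n (label (firstBits n) x)))))

  bitMatrix : Homeo M → ℕ → Mat
  bitMatrix g n = matrix g (firstBits n) (firstBits-surjective n)

  -- Generic elements

  Amalgamable : ∀ {A′ A} → A′ ⇒ A → Set₁
  Amalgamable {A′} p = ∀ {B₀ B₁} (r₀ : B₀ ⇒ A′) (r₁ : B₁ ⇒ A′) →
    ∃[ C ] Σ[ s₀ ∈ C ⇒ B₀ ] Σ[ s₁ ∈ C ⇒ B₁ ] (map p ∘ map r₀ ∘ map s₀ ≗ map p ∘ map r₁ ∘ map s₁)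

  DenseOpen : ∀ {ℓ} → Pred (Homeo M) ℓ → Set (lsuc 0ℓ Level.⊔ ℓ)
  DenseOpen D = ∀ g N → Σ[ h ∈ Homeo M ] (Near N g h × ∃[ N′ ] (∀ k → Near N′ h k → k ∈ D))

  denseOpen-∩ : ∀ {ℓ ℓ′} {D : Pred (Homeo M) ℓ} {E : Pred (Homeo M) ℓ′} → DenseOpen D → DenseOpen E → DenseOpen (D ∩ E)
  denseOpen-∩ D-dense E-dense g N =
    let h , g~h , N₁ , ⊆D = D-dense g N
        k , h~k , N₂ , ⊆E = E-dense h (N ⊔ N₁)
    in k , near-trans {N} {g} {h} {k} g~h (λ x → ≡[]-⊔ˡ N N₁ (h~k x)) , N₁ ⊔ N₂ , λ l k~l →
       ⊆D l (near-trans {N₁} {h} {k} {l} (λ x → ≡[]-⊔ʳ N N₁ (h~k x)) (λ x → ≡[]-⊔ˡ N₁ N₂ (k~l x))) ,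
       ⊆E l (λ x → ≡[]-⊔ʳ N₁ N₂ (k~l x))

  enumerate : ℕ → ℝ
  enumerate n = proj₁ (Bijection.to (GroupLike.countable V-groupLike) n)

  index : ∀ {v} → v ∈ V → ∃[ n ] enumerate n ≈ v
  index v∈V = let n , to≈ = Bijection.surjective (GroupLike.countable V-groupLike) (_ , v∈V) in n , to≈ ≡.refl

  -- Matrices over the first n bits, up to isomorphism: only the entries of a
  -- matrix and the map to the bits matter, and these range over a countable set.
  Task : Set
  Task = Σ[ n ∈ ℕ ] Σ[ k ∈ ℕ ] (Vec (Vec ℕ k) k × Vec (Fin (2 ^ n)) k)

  code : Task → ℕ
  code (n , k , E , q) = code₂ n (code₂ k (code₂ (codeVec (codeVec id) E) (codeVec toℕ q)))

  code-injective : ∀ {s t} → code s ≡ code t → s ≡ t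
  code-injective {n , k , E , q} {n′ , k′ , E′ , q′} eq
    with ≡.refl , eq₁ ← code₂-injective n _ n′ _ eq
    with ≡.refl , eq₂ ← code₂-injective k _ k′ _ eq₁
    with E≡ , q≡ ← code₂-injective (codeVec (codeVec id) E) _ (codeVec (codeVec id) E′) _ eq₂
    = ≡.cong₂ (λ E q → n , k , E , q) (codeVec-injective (codeVec-injective id) E≡) (codeVec-injective Fin.toℕ-injective q≡)

  Solves : Homeo M → Task → Set
  Solves g (n , k , E , q) = Σ[ c ∈ Labelling k ]
    ((∀ i j → joint c (pull g c) i j ≈ enumerate (lookup (lookup E i) j)) × lookup q ∘ label c ≗ label (firstBits n))

  Decides : Homeo M → Task → Set₁
  Decides g t = Solves g t ⊎ ∃[ N ] (∀ h → Near N g h → ¬ Solves h t)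

  -- Solving is open by `realises-near`, and an open set together with the interior of its
  -- complement is open and dense.
  decides-dense : ∀ t → DenseOpen (λ g → Decides g t)
  decides-dense t g N with lem {P = Σ[ h ∈ Homeo M ] (Near N g h × Solves h t)}
  ... | yes (h , g~h , c , joint≈ , q∘c≗) = h , g~h , ldepth c , λ k h~k →
          inj₁ (c , (λ i j → ℝ-group.trans (realises-near {h} {k} {b = c} h~k i j) (joint≈ i j)) , q∘c≗)
  ... | no none = g , near-refl {N} g , N , λ k g~k →
          inj₂ (N , λ h k~h h-solves → none (h , near-trans {N} {g} {k} {h} g~k k~h , h-solves))

  -- Indexed by numbers, as `baire` expects. A number codes at most one task, and nothing is
  -- demanded at a number that is no code.
  decides-code-dense : ∀ u → DenseOpen (λ g → ∀ t → code t ≡ u → Decides g t)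
  decides-code-dense u g N with lem {P = ∃[ t ] code t ≡ u}
  ... | no none = g , near-refl {N} g , N , λ _ _ t code-t → ⊥-elim (none (t , code-t))
  ... | yes (t , ≡.refl) = let h , g~h , N′ , decides = decides-dense t g N in h , g~h , N′ , λ k h~k s code-s →
          ≡.subst (Decides k) (≡.sym (code-injective {s} {t} code-s)) (decides k h~k)

  -- The target of `p` belongs to a fixed `base` and not to g, so that the data survive small
  -- changes of g, as `hasAmalgam-stable` shows.
  record HasAmalgam (n : ℕ) (g : Homeo M) : Set₁ where
    field
      bits     : ℕ
      n≤bits   : n ℕ.≤ bits
      base     : Homeo M
      A′       : Mat
      p        : A′ ⇒ bitMatrix base bits
      p-amalg  : Amalgamable p
      a′       : Labelling (dim A′)
      realises : Realises g A′ a′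
      p∘a′     : map p ∘ label a′ ≗ label (firstBits bits)

  hasAmalgam-stable : ∀ {n h} (am : HasAmalgam n h) → ∀ k → Near (ldepth (HasAmalgam.a′ am)) h k → HasAmalgam n k
  hasAmalgam-stable {n} {h} am k h~k = record
    { bits     = bits
    ; n≤bits   = n≤bits
    ; base     = base
    ; A′       = A′
    ; p        = p
    ; p-amalg  = p-amalg
    ; a′       = a′
    ; realises = λ i j → ℝ-group.trans (realises-near {h} {k} {b = a′} h~k i j) (realises i j)
    ; p∘a′     = p∘a′ }
    where open HasAmalgam am

  record WeakBase (A : Mat) : Set₁ where
    field
      A′      : Mat
      p       : A′ ⇒ A
      p-amalg : Amalgamable p

  mkAmalgam : ∀ n g K → n ℕ.≤ K → (W : WeakBase (bitMatrix g K)) → let open WeakBase W in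
    ∀ h (a′ : Labelling (dim A′)) → Realises h A′ a′ → map p ∘ label a′ ≗ label (firstBits K) → HasAmalgam n h
  mkAmalgam n g K n≤K W h a′ realises p∘a′ = record
    { bits     = K
    ; n≤bits   = n≤K
    ; base     = g
    ; A′       = A′
    ; p        = p
    ; p-amalg  = p-amalg
    ; a′       = a′
    ; realises = realises
    ; p∘a′     = p∘a′ }
    where open WeakBase W

  hasAmalgam-near : ∀ n g N K → n ℕ.≤ K → N ℕ.≤ K → WeakBase (bitMatrix g K) →
                    Σ[ h ∈ Homeo M ] (Near N g h × ∃[ N′ ] (∀ k → Near N′ h k → HasAmalgam n k))
  hasAmalgam-near n g N K n≤K N≤K W = finish (realise g (firstBits K) (firstBits-surjective K) p)
    where
    open WeakBase W
    finish : Σ[ h ∈ Homeo M ] Σ[ b ∈ Labelling (dim A′) ]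
               (map p ∘ label b ≗ label (firstBits K) × Realises h A′ b ×
                label (firstBits K) ∘ to h ≗ label (firstBits K) ∘ to g) →
             Σ[ h ∈ Homeo M ] (Near N g h × ∃[ N′ ] (∀ k → Near N′ h k → HasAmalgam n k))
    finish (h , a′ , p∘a′ , real-a′ , bits≗) =
      h , (λ x → ≡[]-mono N≤K (firstBits-near K {g} {h} bits≗ x)) , ldepth a′ ,
      hasAmalgam-stable {n} {h} (mkAmalgam n g K n≤K W h a′ real-a′ p∘a′)

  module _ (wap : WeakAmalgamation (𝓜 V M)) where

    weakBase : ∀ A → WeakBase A
    weakBase A = record
      { A′      = proj₁ (wap A)
      ; p       = proj₁ (proj₂ (wap A))
      ; p-amalg = λ r₀ r₁ → proj₂ (proj₂ (wap A)) r₀ r₁ }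

    hasAmalgam-dense : ∀ n → DenseOpen (HasAmalgam n)
    hasAmalgam-dense n g N = hasAmalgam-near n g N (n ⊔ N) (ℕ.m≤m⊔n n N) (ℕ.m≤n⊔m n N) (weakBase (bitMatrix g (n ⊔ N)))

    generic : Σ[ g ∈ Homeo M ] ((∀ n → HasAmalgam n g) × (∀ t → Decides g t))
    generic = let g , g∈ = baire _ λ n → denseOpen-∩ (hasAmalgam-dense n) (decides-code-dense n) in
      g , (proj₁ ∘ g∈) , λ t → proj₂ (g∈ (code t)) t ≡.refl

  -- The conjugacy class of a generic element

  conjugate : Homeo M → Homeo M → Homeo M
  conjugate g k = _∘ʰ_ M (_∘ʰ_ M k g) (_⁻¹ʰ M k)

  conjugate-near : ∀ g k n → ∃[ N ] (∀ l → Near N k l → Near n (conjugate g k) (conjugate g l))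
  conjugate-near g k n =
    let Q , x≡⇒ = to-uniform (_∘ʰ_ M k g) n
        N , inv = inverse-near k Q
    in n ⊔ N , λ l k~l y → ≡[]-trans (≡[]-⊔ˡ n N (k~l (to g (from l y)))) (x≡⇒ (inv l (λ x → ≡[]-⊔ʳ n N (k~l x)) y))

  module NonMeager (g : Homeo M) (amalgams : ∀ n → HasAmalgam n g) (decides : ∀ t → Decides g t) where

    module _ {n : ℕ} (am : HasAmalgam n g) where
      open HasAmalgam am

      -- Compatibility is asked only after `p`, because weak amalgamation gives no equation before
      -- it.
      Occurrence : ∀ {B} → B ⇒ A′ → Homeo M → Set
      Occurrence {B} r h = Σ[ c ∈ Labelling (dim B) ] (Realises h B c × map p ∘ map r ∘ label c ≗ label (firstBits bits))

      -- Since J bits determine `a′`, the bit matrix of g maps to `A′` just as B does. An amalgam C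
      -- is realised over these bits by some h near g, and `s₁` reads off B from it.
      occurs-near : ∀ {B} (r : B ⇒ A′) J (ρ : Fin (2 ^ J) → Fin (dim A′)) → ρ ∘ label (firstBits J) ≗ label a′ →
                    Σ[ h ∈ Homeo M ] (Near J g h × Occurrence r h)
      occurs-near {B} r J ρ ρ∘bits = amalgamate (p-amalg r₀ r)
        where
        r₀ : bitMatrix g J ⇒ A′
        r₀ = coarsening {g = g} {firstBits J} (firstBits-surjective J) {A′} {a′} realises ρ ρ∘bits

        finish : ∀ {C} (s₀ : C ⇒ bitMatrix g J) (s₁ : C ⇒ B) → map p ∘ ρ ∘ map s₀ ≗ map p ∘ map r ∘ map s₁ →
          Σ[ h ∈ Homeo M ] Σ[ d ∈ Labelling (dim C) ]
            (map s₀ ∘ label d ≗ label (firstBits J) × Realises h C d ×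
             label (firstBits J) ∘ to h ≗ label (firstBits J) ∘ to g) →
          Σ[ h ∈ Homeo M ] (Near J g h × Occurrence r h)
        finish {C} s₀ s₁ commutes (h , d , s₀∘d , real-d , near) =
          h , firstBits-near J {g} {h} near , mapˡ (map s₁) d , realises-map {h} {C} {B} {d} real-d s₁ ,
          λ x → ≡.trans (≡.sym (commutes (label d x)))
            (≡.trans (≡.cong (map p ∘ ρ) (s₀∘d x)) (≡.trans (≡.cong (map p) (ρ∘bits x)) (p∘a′ x)))

        amalgamate : (∃[ C ] Σ[ s₀ ∈ C ⇒ bitMatrix g J ] Σ[ s₁ ∈ C ⇒ B ] (map p ∘ ρ ∘ map s₀ ≗ map p ∘ map r ∘ map s₁)) →
          Σ[ h ∈ Homeo M ] (Near J g h × Occurrence r h)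
        amalgamate (C , s₀ , s₁ , commutes) =
          finish {C} s₀ s₁ commutes (realise g (firstBits J) (firstBits-surjective J) {C} s₀)

      -- Amalgamating r with the matrices of fine partitions for g shows that B
      -- occurs over the first bits arbitrarily close to g. Since g has decided
      -- whether it does, it occurs for g.
      absorb : ∀ {B} (r : B ⇒ A′) → Occurrence r g
      absorb {B} r = decided (decides task)
        where
        indices : Vec (Vec ℕ (dim B)) (dim B)
        indices = tabulate λ i → tabulate λ j → proj₁ (index (entry∈V B i j))

        task : Task
        task = bits , dim B , indices , tabulate (map p ∘ map r)

        encoded : ∀ i j → enumerate (lookup (lookup indices i) j) ≈ entry B i j
        encoded i j = ≡.subst (λ n → enumerate n ≈ entry B i j)
          (≡.sym (≡.trans (≡.cong (λ row → lookup row j) (Vec.lookup∘tabulate _ i)) (Vec.lookup∘tabulate _ j)))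
          (proj₂ (index (entry∈V B i j)))

        solves : ∀ {h} → Occurrence r h → Solves h task
        solves (c , real-c , p∘r∘c) = c , (λ i j → ℝ-group.trans (real-c i j) (ℝ-group.sym (encoded i j))) ,
          λ x → ≡.trans (Vec.lookup∘tabulate (map p ∘ map r) (label c x)) (p∘r∘c x)

        decided : Decides g task → Occurrence r g
        decided (inj₁ (c , joint≈ , q∘c≗)) = c , (λ i j → ℝ-group.trans (joint≈ i j) (encoded i j)) ,
          λ x → ≡.trans (≡.sym (Vec.lookup∘tabulate (map p ∘ map r) (label c x))) (q∘c≗ x)
        decided (inj₂ (N , none)) =
          let J = N ⊔ ldepth a′
              ρ , ρ∘bits = factor J a′ (ℕ.m≤n⊔m N (ldepth a′))
              h , g~h , occurs = occurs-near r J ρ ρ∘bits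
          in ⊥-elim (none h (λ x → ≡[]-⊔ˡ N (ldepth a′) (g~h x)) (solves {h} occurs))

    -- Otherwise every open set around a point of the ball meets F, so the ball lies in the closure
    -- of F.
    escape : ∀ {F} → HomeoTopology.NowhereDense M F → ∀ n h₀ →
             Σ[ h ∈ Homeo M ] (Near n h₀ h × ∃[ K ] (∀ k → Near K h k → k ∉ F))
    escape {F} F-nowhere-dense n h₀ with lem {P = Σ[ h ∈ Homeo M ] (Near n h₀ h × ∃[ K ] (∀ k → Near K h k → k ∉ F))}
    ... | yes found = found
    ... | no  none  = ⊥-elim (F-nowhere-dense (Ball n h₀) (λ {h} → ball-open n h₀ {h}) ball⊆closure (h₀ , lift (near-refl {n} h₀)))
      where
      ball⊆closure : Ball n h₀ ⊆ HomeoTopology.Closure M F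
      ball⊆closure {h} h∈ball W W-open h∈W with lem {P = Satisfiable (W ∩ F)}
      ... | yes meets  = meets
      ... | no ¬meets = ⊥-elim (none (h , lower h∈ball , let K , ⊆W = open-ball W-open h∈W in
              K , λ k h~k k∈F → ¬meets (k , ⊆W k h~k , k∈F)))

    Approached : ∀ {ℓ} → Pred (Homeo M) ℓ → Homeo M → ℕ → Set (lsuc 0ℓ Level.⊔ ℓ)
    Approached D k N = Σ[ l ∈ Homeo M ] (Near N k l × ∃[ R ] (∀ l′ → Near R l l′ → conjugate g l′ ∈ D))

    module _ {ℓ : Level} {D : Pred (Homeo M) ℓ} (k : Homeo M) {N m : ℕ} (modulus : ∀ {x y} → x ≡[ m ] y → to k x ≡[ N ] to k y)
      (am : HasAmalgam m g) where
      open HasAmalgam am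

      -- `a′` transported by k: it realises `A′` for k g k⁻¹ as `a′` does for g.
      b′ : Labelling (dim A′)
      b′ = pull (_⁻¹ʰ M k) a′

      module _ (h : Homeo M) (h₀~h : Near (ldepth b′) (conjugate g k) h) (J : ℕ) (ball⊆D : ∀ l → Near J h l → l ∈ D)
        (ρ : Fin (2 ^ J) → Fin (dim A′)) (ρ∘bits : ρ ∘ label (firstBits J) ≗ label b′) where

        real-b′ : Realises h A′ b′
        real-b′ i j = ℝ-group.trans (realises-near {conjugate g k} {h} {b = b′} h₀~h i j)
          (ℝ-group.trans
            (joint-cong b′ b′ (pull (conjugate g k) b′) (pull (_⁻¹ʰ M k) (pull g a′)) (λ _ → ≡.refl)
              (λ x → lresp a′ (≗⇒≡[] (strictlyInverseʳ k (to g (from k x))))) i j)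
            (ℝ-group.trans
              (m-pull (_⁻¹ʰ M k) (loc-∩ (at a′ i) (at (pull g a′) j))
                (loc-∩ (at b′ i) (at (pull (_⁻¹ʰ M k) (pull g a′)) j)))
              (realises i j)))

        -- The pair c, c ∘ g has the joint weights of the bits and their composite with h, so some l
        -- carries one pair to the other. Then l g l⁻¹ and h have the same J bits.
        conjugate-into : ∀ (c : Labelling (2 ^ J)) →
          (∀ i j → joint c (pull g c) i j ≈ joint (firstBits J) (pull h (firstBits J)) i j) →
          map p ∘ ρ ∘ label c ≗ label (firstBits bits) → Approached D k N
        conjugate-into c real-c p∘ρ∘c = finish (homogeneous (matching ⟨ c , pull g c ⟩ ⟨ firstBits J , pull h (firstBits J) ⟩ same-wt))
          where
          same-wt : ∀ i → wt ⟨ c , pull g c ⟩ i ≈ wt ⟨ firstBits J , pull h (firstBits J) ⟩ i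
          same-wt i with Fin.combine-surjective {2 ^ J} {2 ^ J} i
          ... | p , q , ≡.refl = ℝ-group.trans (wt-⟨⟩ c (pull g c) p q)
                  (ℝ-group.trans (real-c p q) (ℝ-group.sym (wt-⟨⟩ (firstBits J) (pull h (firstBits J)) p q)))

          finish : Σ[ l ∈ Homeo M ] (label ⟨ firstBits J , pull h (firstBits J) ⟩ ∘ to l ≗ label ⟨ c , pull g c ⟩) →
                   Approached D k N
          finish (l , labels≗) = l , k~l , proj₁ (conjugate-near g l J) , λ l′ l~l′ → ball⊆D (conjugate g l′)
              (near-trans {J} {h} {conjugate g l} {conjugate g l′} h~conjugate (proj₂ (conjugate-near g l J) l′ l~l′))
            where
            bits-l : ∀ x → label (firstBits J) (to l x) ≡ label c x
            bits-l x = Fin.combine-injectiveˡ (label (firstBits J) (to l x)) (label (firstBits J) (to h (to l x)))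
              (label c x) (label c (to g x)) (labels≗ x)

            bits-hl : ∀ x → label (firstBits J) (to h (to l x)) ≡ label c (to g x)
            bits-hl x = Fin.combine-injectiveʳ (label (firstBits J) (to l x)) (label (firstBits J) (to h (to l x)))
              (label c x) (label c (to g x)) (labels≗ x)

            -- Through `p`, the label of k⁻¹ (l x) is the one of x, so these points share `bits`
            -- bits, at least m; the modulus of k then compares l x with k x.
            k~l : Near N k l
            k~l x = ≡[]-trans (≗⇒≡[] (λ i → ≡.sym (strictlyInverseˡ k (to l x) i)))
              (≡[]-sym (modulus (≡[]-mono n≤bits (firstBits-injective bits (≡.trans (≡.sym (p∘ρ∘c x))
                (≡.trans (≡.cong (map p ∘ ρ) (≡.sym (bits-l x)))
                  (≡.trans (≡.cong (map p) (ρ∘bits (to l x))) (p∘a′ (from k (to l x))))))))))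

            h~conjugate : Near J h (conjugate g l)
            h~conjugate y = ≡[]-trans
              (firstBits-injective J (≡.trans (bits-l (to g (from l y))) (≡.sym (bits-hl (from l y)))))
              (≗⇒≡[] (to-cong h (strictlyInverseˡ l y)))

        approached : Approached D k N
        approached = finish (absorb am (coarsening {g = h} {firstBits J} (firstBits-surjective J) {A′} {b′} real-b′ ρ ρ∘bits))
          where
          finish : Σ[ c ∈ Labelling (2 ^ J) ]
                     (Realises g (bitMatrix h J) c × map p ∘ ρ ∘ label c ≗ label (firstBits bits)) →
                   Approached D k N
          finish (c , real-c , p∘ρ∘c) = conjugate-into c real-c p∘ρ∘c

    -- The order of choices matters: k and N fix the scale m, m fixes the amalgam, its transported
    -- labelling fixes how close h must stay to k g k⁻¹ to realise `A′`, and only then does nowhere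
    -- density supply h.
    avoid : ∀ {F} → HomeoTopology.NowhereDense M F → DenseOpen (λ k → conjugate g k ∉ F)
    avoid {F} F-nowhere-dense k N =
      let m , modulus = to-uniform k N
          am = amalgams m
          b = pull (_⁻¹ʰ M k) (HasAmalgam.a′ am)
          h , h₀~h , K , avoids = escape F-nowhere-dense (ldepth b) (conjugate g k)
          J = K ⊔ ldepth b
          ρ , ρ∘bits = factor J b (ℕ.m≤n⊔m K (ldepth b))
      in approached {D = _∉ F} k modulus am h h₀~h J
           (λ l h~l → avoids l (λ x → ≡[]-⊔ˡ K (ldepth b) (h~l x))) ρ ρ∘bits

    conjugate-∈ : ∀ k → conjugate g k ∈ ConjugacyClass (Homeo-group M) g
    conjugate-∈ k = k , λ _ _ → ≡.refl

    nonMeager : ¬ HomeoTopology.Meager M (ConjugacyClass (Homeo-group M) g)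
    nonMeager (F , F-nowhere-dense , class⊆) =
      escaped (baire (λ n k → conjugate g k ∉ F n) (λ n → avoid (F-nowhere-dense n)))
      where
      escaped : ¬ (Σ[ k ∈ Homeo M ] (∀ n → conjugate g k ∉ F n))
      escaped (k , k∉) = k∉ (proj₁ (class⊆ (conjugate-∈ k))) (proj₂ (class⊆ (conjugate-∈ k)))

  exists-nonMeager : WeakAmalgamation (𝓜 V M) →
                     Σ[ g ∈ Homeo M ] ¬ HomeoTopology.Meager M (ConjugacyClass (Homeo-group M) g)
  exists-nonMeager wap = finish (generic wap)
    where
    finish : (Σ[ g ∈ Homeo M ] ((∀ n → HasAmalgam n g) × (∀ t → Decides g t))) →
             Σ[ g ∈ Homeo M ] ¬ HomeoTopology.Meager M (ConjugacyClass (Homeo-group M) g)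
    finish (g , amalgams , decides) = g , NonMeager.nonMeager g amalgams decides

open import Defs

theorem4p9 : (∀ {ℓ} → ExcludedMiddle ℓ) →
    (V : Pred ℝ 0ℓ) → GroupLike V →
    (μ : Measure) → Good μ → ClopenValues μ ≐ V →
    WeakAmalgamation (𝓜 V μ) →
    Σ[ g ∈ Homeo μ ] ¬ HomeoTopology.Meager μ (ConjugacyClass (Homeo-group μ) g)
theorem4p9 lem V V-groupLike μ good values≐V = exists-nonMeager
  where open Construction lem V V-groupLike μ good values≐V
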